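{- For every positive integer $N$, there exists a graph with exactly $N^2+N$ vertices that contains no $K_{2,2}$ subgraph, whose twin-width is at most $3$ and whose tree-width is at least $N$.
   Context: All graphs are finite and simple (no loops, no multiple edges). "Subgraph" means not necessarily induced subgraph. $K_{2,2}$ is the complete bipartite graph with both sides of size $2$, i.e. the $4$-cycle. Tree-width is the usual notion (minimum over tree-decompositions of the maximum bag size minus one). Trigraph: a simple graph $G$ in which some edges are marked red (the other edges are black). "Neighbour" and $N_G(x)$ refer to all edges (red and black); $N^r_G(x)$ denotes the set of red neighbours of $x$, and the red degree of $x$ is $|N_G^r(x)|$. A contraction of a pair of distinct (not necessarily adjacent) vertices $x_1,x_2$ of a trigraph $G$ produces the trigraph $G'$ that is the same as $G$ except that $x_1,x_2$ are replaced by one new vertex $x_0$ with $N_{G'}(x_0)=(N_G(x_1)\cup N_G(x_2))\setminus\{x_1,x_2\}$ and $N^r_{G'}(x_0)=\big(N^r_G(x_1)\cup N^r_G(x_2)\cup (N_G(x_1)\,\Delta\, N_G(x_2))\big)\setminus\{x_1,x_2\}$, where $\Delta$ is symmetric difference. A contraction sequence of a trigraph $G$ is a sequence of successive contractions turning $G$ into a single vertex; its width is the maximum red degree of any vertex in any trigraph of the sequence. The twin-width of $G$ is the minimum width over all contraction sequences of $G$. For an ordinary graph $G$, these notions are applied to $G$ viewed as a trigraph with no red edges. -}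

module Defs where

open import Data.Bool.Base using (Bool; true; false; _xor_)
open import Data.Bool.Properties using (xor-comm; xor-same)
open import Data.Empty using (⊥-elim)
open import Data.Fin.Base using (Fin; zero; suc; inject₁; fromℕ; splitAt)
open import Data.Fin.Subset using
  (Subset; _∈_; _∉_; _⊆_; _∪_; _─_; ⁅_⁆; ⊥; ⊤; ∣_∣)
open import Data.Fin.Subset.Properties using (∈⊤; ∉⊥)
open import Data.List.Base using (map; allFin)
open import Data.List.Extrema.Nat using (max)
open import Data.Nat.Base using (ℕ; _+_; _∸_; _⊔_; _≤_; NonZero)
open import Data.Product.Base using (Σ-syntax; ∃-syntax; _×_)
open import Data.Sum.Base using ([_,_]′)
open import Data.Unit.Base using () renaming (⊤ to Unit)
open import Data.Vec.Base using (tabulate)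
open import Data.Vec.Properties using (lookup∘tabulate; []=⇒lookup; lookup⇒[]=)
open import Function.Base using (const)
open import Function.Bundles using (_⇔_)
open import Function.Definitions using (Injective)
open import Relation.Binary.Construct.Closure.ReflexiveTransitive using (Star)
open import Relation.Binary.PropositionalEquality
  using (_≡_; _≢_; sym; trans)
open import Relation.Nullary.Negation using (¬_)

infix 4 _⊑_
infixr 6 _△_

-- A finite simple graph on the vertex set Fin n; nbhd x is N(x).
record Graph (n : ℕ) : Set where
  field
    nbhd        : Fin n → Subset n
    symmetric   : ∀ {x y} → y ∈ nbhd x → x ∈ nbhd y
    irreflexive : ∀ {x} → x ∉ nbhd x

Adj : ∀ {n} → Graph n → Fin n → Fin n → Set
Adj G x y = y ∈ Graph.nbhd G x

-- H is (isomorphic to) a not necessarily induced subgraph of G.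
_⊑_ : ∀ {m n} → Graph m → Graph n → Set
_⊑_ {m} {n} H G = Σ[ f ∈ (Fin m → Fin n) ]
  Injective _≡_ _≡_ f × (∀ {x y} → Adj H x y → Adj G (f x) (f y))

-- The complete bipartite graph: the first a vertices form one side and the
-- last b vertices the other.
K : (a b : ℕ) → Graph (a + b)
K a b = record
  { nbhd        = λ x → tabulate (λ y → side x xor side y)
  ; symmetric   = λ {x} {y} p → lookup⇒[]= x _
      (trans (lookup∘tabulate (λ z → side y xor side z) x)
      (trans (xor-comm (side y) (side x)) (edge p)))
  ; irreflexive = λ {x} p → true≢false (trans (sym (edge p)) (xor-same (side x)))
  }
  where
  side : Fin (a + b) → Bool
  side x = [ const true , const false ]′ (splitAt a x)

  edge : ∀ {x y} → y ∈ tabulate (λ z → side x xor side z) → side x xor side y ≡ true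
  edge {x} {y} p = trans (sym (lookup∘tabulate (λ z → side x xor side z) y)) ([]=⇒lookup p)

  true≢false : true ≢ false
  true≢false ()

-- A trigraph whose vertices form a subset V of the label set Fin n; its size
-- is ∣ V ∣, which decreases under contraction while n stays fixed.
-- nbhd x is N(x), over red and black edges together, and redNbhd x is Nʳ(x);
-- both are empty when x ∉ V.
record Trigraph (n : ℕ) : Set where
  field
    V             : Subset n
    nbhd          : Fin n → Subset n
    redNbhd       : Fin n → Subset n
    nbhd⊆V        : ∀ {x} → nbhd x ⊆ V
    redNbhd⊆nbhd  : ∀ {x} → redNbhd x ⊆ nbhd x
    symmetric     : ∀ {x y} → y ∈ nbhd x → x ∈ nbhd y
    red-symmetric : ∀ {x y} → y ∈ redNbhd x → x ∈ redNbhd y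
    irreflexive   : ∀ {x} → x ∉ nbhd x

toTrigraph : ∀ {n} → Graph n → Trigraph n
toTrigraph G = record
  { V             = ⊤
  ; nbhd          = Graph.nbhd G
  ; redNbhd       = const ⊥
  ; nbhd⊆V        = λ _ → ∈⊤
  ; redNbhd⊆nbhd  = λ p → ⊥-elim (∉⊥ p)
  ; symmetric     = Graph.symmetric G
  ; red-symmetric = λ p → ⊥-elim (∉⊥ p)
  ; irreflexive   = Graph.irreflexive G
  }

_△_ : ∀ {n} → Subset n → Subset n → Subset n
p △ q = (p ─ q) ∪ (q ─ p)

-- G′ arises from G by contracting x₁ and x₂. The label x₀ of the new vertex
-- may be any one not used by a remaining vertex; in particular it may be x₁ or
-- x₂, so a free label always exists. Symmetry of G′ makes the conditions
-- below determine all of its edges.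
record Contraction {n} (G G′ : Trigraph n) : Set where
  private
    module G  = Trigraph G
    module G′ = Trigraph G′
  field
    x₁ x₂ x₀ : Fin n
    x₁∈V     : x₁ ∈ G.V
    x₂∈V     : x₂ ∈ G.V
    x₁≢x₂    : x₁ ≢ x₂

  pair : Subset n
  pair = ⁅ x₁ ⁆ ∪ ⁅ x₂ ⁆

  rest : Subset n
  rest = G.V ─ pair

  field
    x₀∉rest      : x₀ ∉ rest
    V-eq         : G′.V ≡ rest ∪ ⁅ x₀ ⁆
    nbhd-x₀      : G′.nbhd x₀ ≡ (G.nbhd x₁ ∪ G.nbhd x₂) ─ pair
    redNbhd-x₀   : G′.redNbhd x₀ ≡
      ((G.redNbhd x₁ ∪ G.redNbhd x₂) ∪ (G.nbhd x₁ △ G.nbhd x₂)) ─ pair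
    nbhd-rest    : ∀ {u v} → u ∈ rest → v ∈ rest →
                   v ∈ G′.nbhd u ⇔ v ∈ G.nbhd u
    redNbhd-rest : ∀ {u v} → u ∈ rest → v ∈ rest →
                   v ∈ G′.redNbhd u ⇔ v ∈ G.redNbhd u

redDegree : ∀ {n} → Trigraph n → Fin n → ℕ
redDegree G x = ∣ Trigraph.redNbhd G x ∣

-- Labels outside V have red degree 0, so they do not affect the maximum.
maxRedDegree : ∀ {n} → Trigraph n → ℕ
maxRedDegree {n} G = max 0 (map (redDegree G) (allFin n))

data ContractionSequence {n} : Trigraph n → Set where
  single : ∀ {G} → ∣ Trigraph.V G ∣ ≡ 1 → ContractionSequence G
  step   : ∀ {G G′} → Contraction G G′ → ContractionSequence G′ →
           ContractionSequence G

seqWidth : ∀ {n} {G : Trigraph n} → ContractionSequence G → ℕ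
seqWidth {G = G} (single _) = maxRedDegree G
seqWidth {G = G} (step _ s) = maxRedDegree G ⊔ seqWidth s

-- The minimum of seqWidth over all contraction sequences is at most k.
TwinWidth≤ : ∀ {n} → Graph n → ℕ → Set
TwinWidth≤ G k = ∃[ s ] seqWidth {G = toTrigraph G} s ≤ k

-- Any two vertices satisfying P are joined by a walk of G all of whose vertices
-- satisfy P.
ConnectedOn : ∀ {n} → Graph n → (Fin n → Set) → Set
ConnectedOn G P = ∀ {x y} → P x → P y →
  Star (λ u v → P u × P v × Adj G u v) x y

-- A cycle through the distinct vertices c 0 , … , c (k + 2).
record Cycle {n} (G : Graph n) : Set where
  field
    {k}       : ℕ
    c         : Fin (3 + k) → Fin n
    injective : Injective _≡_ _≡_ c
    adjacent  : ∀ i → Adj G (c (inject₁ i)) (c (suc i))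
    closing   : Adj G (c (fromℕ (2 + k))) (c zero)

record IsTree {n} (T : Graph n) : Set where
  field
    nonEmpty  : NonZero n
    connected : ConnectedOn T (λ _ → Unit)
    acyclic   : ¬ Cycle T

record TreeDecomposition {n} (G : Graph n) : Set where
  field
    {nodes}       : ℕ
    tree          : Graph nodes
    isTree        : IsTree tree
    bag           : Fin nodes → Subset n
    vertexCovered : ∀ x → ∃[ t ] x ∈ bag t
    edgeCovered   : ∀ {x y} → Adj G x y → ∃[ t ] (x ∈ bag t × y ∈ bag t)
    bagsConnected : ∀ x → ConnectedOn tree (λ t → x ∈ bag t)

  -- The largest bag size minus one; truncation only matters when all bags are
  -- empty, which forces n ≡ 0.
  width : ℕ
  width = max 0 (map (λ t → ∣ bag t ∣) (allFin nodes)) ∸ 1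

-- The minimum of width over all tree-decompositions is at least k.
TreeWidth≥ : ∀ {n} → Graph n → ℕ → Set
TreeWidth≥ G k = ∀ (D : TreeDecomposition G) → k ≤ TreeDecomposition.width D

{-# OPTIONS --safe #-}

-- G consists of N disjoint paths on N vertices and N hubs, the j-th hub being
-- adjacent to the j-th vertex of every path.  Two vertices have at most one
-- common neighbour.  Contracting the paths and keeping the hubs gives a
-- K_{N,N} minor, whose minimum degree N bounds the tree-width from below.  For
-- the twin-width, the paths are merged one after the other into the last one,
-- vertex by vertex, and then the hubs are merged into it.  Only vertices of the
-- same column are identified and the hub of a column sees all the paths there,
-- so hub edges stay black; red degree 3 occurs only at the boundary between the
-- merged and the unmerged part of a path.  What is left is a path, which is
-- shortened from its end.
module Submission where

open import Defs
open import Data.Bool.Base using (true)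
open import Data.Fin.Base
  using (Fin; zero; suc; toℕ; fromℕ; fromℕ<; combine; remQuot; pred; splitAt; _↑ˡ_; _↑ʳ_)
open import Data.Fin.Induction using (<-weakInduction)
open import Data.Fin.Patterns using (0F; 1F; 2F; 3F)
open import Data.Fin.Properties as Fin using
  (_≟_; any?; all?; pigeonhole; toℕ-injective; toℕ-inject₁; toℕ-fromℕ; toℕ-fromℕ<; toℕ<n; 0≢1+n;
   toℕ-combine; combine-monoˡ-<; remQuot-combine; combine-remQuot;
   ↑ˡ-injective; ↑ʳ-injective; splitAt-↑ˡ; splitAt-↑ʳ; splitAt⁻¹-↑ˡ; splitAt⁻¹-↑ʳ)
open import Data.Fin.Subset using
  (Subset; _∈_; _∉_; _⊆_; _∪_; _─_; _-_; ⁅_⁆; ⊤; ∣_∣; inside; outside)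
open import Data.Fin.Subset.Properties
open import Data.List.Base using (List; []; _∷_; length; map; allFin)
open import Data.List.Extrema.Nat using (argmax; f[xs]≤f[argmax]; max≤v⁺; v≤max⁺)
open import Data.List.Membership.Propositional using (lose) renaming (_∈_ to _∈ˡ_)
open import Data.List.Membership.Propositional.Properties using (∈-allFin; ∈-map⁺)
open import Data.List.Properties using (length-map)
import Data.List.Relation.Unary.All as All
import Data.List.Relation.Unary.All.Properties as All
open import Data.List.Relation.Unary.Any using (here; there)
open import Data.Nat.Base using (ℕ; zero; suc; _+_; _*_; _^_; _≤_; _<_; z≤n; s≤s; NonZero)
open import Data.Nat.Induction using (<-rec)
open import Data.Nat.Properties as ℕ using
  (*-identityʳ; +-comm; +-monoˡ-<; +-suc; 1+n≢n; <-asym; <-cmp; <-irrefl; <⇒≢; <⇒≤; <⇒≱; _<?_;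
   anyUpTo?; m<1+n⇒m≤n; m<n⇒m<1+n; m≢1+m+n; m≤n⇒m≤1+n; m≤n⇒∃[o]m+o≡n; n<1+n; n≤1+n; ∸-monoˡ-≤;
   ≤-<-trans; ≤-antisym; ≤-pred; ≤-refl; ≤-reflexive; ≤-trans; ≤⇒≯; ≤∧≢⇒<; ≮⇒≥; ⊔-lub)
open import Data.Product.Base using (Σ-syntax; ∃-syntax; ∃₂; _×_; _,_; proj₁; proj₂; uncurry)
open import Data.Sum.Base as Sum using (_⊎_; inj₁; inj₂; swap)
open import Data.Vec.Base using ([]; _∷_; here; there; lookup; tabulate)
open import Data.Vec.Properties using (lookup∘tabulate; []=⇒lookup; lookup⇒[]=)
open import Function.Base using (_∘_; id)
open import Function.Bundles using (_⇔_; mk⇔; module Equivalence)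
open import Function.Definitions using (Injective)
open import Relation.Binary.Construct.Closure.ReflexiveTransitive
  using (Star; ε; _◅_; _◅◅_; gmap; reverse)
open import Relation.Binary.Definitions using (tri<; tri≈; tri>)
open import Relation.Binary.PropositionalEquality
open import Relation.Nullary.Decidable
  using (Dec; does; dec-true; yes; no; _×-dec_; _⊎-dec_; _→-dec_; ¬?)
open import Relation.Nullary.Negation using (contradiction; ¬_)
open import Relation.Unary using (Decidable)

-- Finite subsets and their sizes

⟦_⟧ : ∀ {n} {P : Fin n → Set} → Decidable P → Subset n
⟦ P? ⟧ = tabulate (does ∘ P?)

module _ {n} {P : Fin n → Set} (P? : Decidable P) where

  ∈⟦⟧⁺ : ∀ {x} → P x → x ∈ ⟦ P? ⟧
  ∈⟦⟧⁺ {x} Px = lookup⇒[]= x _ (trans (lookup∘tabulate (does ∘ P?) x) (dec-true (P? x) Px))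

  ∈⟦⟧⁻ : ∀ {x} → x ∈ ⟦ P? ⟧ → P x
  ∈⟦⟧⁻ {x} x∈ with P? x | trans (sym (lookup∘tabulate (does ∘ P?) x)) ([]=⇒lookup x∈)
  ... | yes Px | _ = Px

x∈p─q⇒x∉q : ∀ {n} {p q : Subset n} {x} → x ∈ p ─ q → x ∉ q
x∈p─q⇒x∉q {p = _ ∷ _} {outside ∷ _} {zero}  _          ()
x∈p─q⇒x∉q {p = _ ∷ _} {_       ∷ _} {suc x} (there x∈) (there x∈q) = x∈p─q⇒x∉q x∈ x∈q

∣p∣≤1+∣p-x∣ : ∀ {n} (p : Subset n) x → ∣ p ∣ ≤ suc ∣ p - x ∣
∣p∣≤1+∣p-x∣ (outside ∷ p) zero    = m≤n⇒m≤1+n (≤-reflexive (cong ∣_∣ (sym (p─⊥≡p p))))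
∣p∣≤1+∣p-x∣ (inside  ∷ p) zero    = s≤s (≤-reflexive (cong ∣_∣ (sym (p─⊥≡p p))))
∣p∣≤1+∣p-x∣ (outside ∷ p) (suc x) = ∣p∣≤1+∣p-x∣ p x
∣p∣≤1+∣p-x∣ (inside  ∷ p) (suc x) = s≤s (∣p∣≤1+∣p-x∣ p x)

module _ {n : ℕ} where

  injection⇒≤∣p∣ : ∀ {k} {p : Subset n} (f : Fin k → Fin n) → Injective _≡_ _≡_ f →
                   (∀ i → f i ∈ p) → k ≤ ∣ p ∣
  injection⇒≤∣p∣ {zero}          f inj f∈ = z≤n
  injection⇒≤∣p∣ {suc k} {p} f inj f∈ = ≤-trans (s≤s smaller) (x∈p⇒∣p-x∣<∣p∣ (f∈ zero))
    where
    smaller : k ≤ ∣ p - f zero ∣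
    smaller = injection⇒≤∣p∣ (f ∘ suc) (Fin.suc-injective ∘ inj)
      λ i → x∈p∧x≢y⇒x∈p-y (f∈ (suc i)) (λ eq → 0≢1+n (sym (inj eq)))

  -- The list may repeat entries or contain elements outside `p`, so a red degree is bounded as soon
  -- as some short list covers the red neighbours.
  ∣p∣≤length : ∀ {p : Subset n} (xs : List (Fin n)) → (∀ {x} → x ∈ p → x ∈ˡ xs) → ∣ p ∣ ≤ length xs
  ∣p∣≤length {p} [] p⊆ = subst (_≤ 0) (sym (trans (cong ∣_∣ (Empty-unique empty)) (∣⊥∣≡0 n))) z≤n
    where
    empty : _
    empty (x , x∈p) with () ← p⊆ x∈p
  ∣p∣≤length {p} (x ∷ xs) p⊆ = ≤-trans (∣p∣≤1+∣p-x∣ p x) (s≤s (∣p∣≤length xs rest))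
    where
    rest : ∀ {y} → y ∈ p - x → y ∈ˡ xs
    rest y∈ with p⊆ (p─q⊆p p ⁅ x ⁆ y∈)
    ... | here refl  = contradiction (x∈⁅x⁆ x) (x∈p─q⇒x∉q y∈)
    ... | there y∈xs = y∈xs

maxRedDegree≤ : ∀ {n} (T : Trigraph n) {k} → (∀ x → redDegree T x ≤ k) → maxRedDegree T ≤ k
maxRedDegree≤ T bound = max≤v⁺ {xs = map (redDegree T) (allFin _)} z≤n (All.map⁺ (All.tabulate λ {x} _ → bound x))

-- Quotients of a graph and their contraction sequences

module Quotient {n} (G : Graph n) where

  private module G = Graph G

  Adjacent NonAdjacent : (Fin n → Fin n) → Fin n → Fin n → Set
  Adjacent    f x y = ∃₂ λ a b → f a ≡ x × f b ≡ y × Adj G a b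
  NonAdjacent f x y = ∃₂ λ a b → f a ≡ x × f b ≡ y × ¬ Adj G a b

  Edge RedEdge : (Fin n → Fin n) → Fin n → Fin n → Set
  Edge    f x y = x ≢ y × Adjacent f x y
  RedEdge f x y = Edge f x y × NonAdjacent f x y

  -- T is the result of identifying the vertices of G along f: two classes are
  -- joined if some of their members are adjacent, and by a black edge only if
  -- all of them are.
  record IsQuotient (f : Fin n → Fin n) (T : Trigraph n) : Set where
    private module T = Trigraph T
    field
      V-image : ∀ {y} → y ∈ T.V ⇔ (∃[ a ] f a ≡ y)
      nbhd⇔   : ∀ {x y} → y ∈ T.nbhd x ⇔ Edge f x y
      red⇔    : ∀ {x y} → y ∈ T.redNbhd x ⇔ RedEdge f x y

  open IsQuotient
  open Equivalence using (to; from)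

  id-isQuotient : IsQuotient id (toTrigraph G)
  id-isQuotient = record
    { V-image = λ {y} → mk⇔ (λ _ → y , refl) (λ _ → ∈⊤)
    ; nbhd⇔   = mk⇔ (λ xy → (λ { refl → G.irreflexive xy }) , _ , _ , refl , refl , xy)
                    (λ { (_ , _ , _ , refl , refl , ab) → ab })
    ; red⇔    = mk⇔ (λ xy → contradiction xy ∉⊥)
                    (λ { ((_ , _ , _ , refl , refl , ab) , _ , _ , refl , refl , ¬ab) → contradiction ab ¬ab })
    }

  IsQuotient-resp-≗ : ∀ {f g T} → f ≗ g → IsQuotient f T → IsQuotient g T
  IsQuotient-resp-≗ {f} {g} f≗g Q = record
    { V-image = mk⇔ (λ y∈ → let (a , eq) = to (V-image Q) y∈ in a , trans (sym (f≗g a)) eq)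
                    (λ (a , eq) → from (V-image Q) (a , trans (f≗g a) eq))
    ; nbhd⇔   = mk⇔ (λ y∈ → let (x≢y , j) = to (nbhd⇔ Q) y∈ in x≢y , go g≗f j)
                    (λ (x≢y , j) → from (nbhd⇔ Q) (x≢y , go f≗g j))
    ; red⇔    = mk⇔ (λ y∈ → let ((x≢y , j) , s) = to (red⇔ Q) y∈ in (x≢y , go g≗f j) , go g≗f s)
                    (λ ((x≢y , j) , s) → from (red⇔ Q) ((x≢y , go f≗g j) , go f≗g s))
    }
    where
    g≗f : g ≗ f
    g≗f a = sym (f≗g a)
    go : ∀ {P : Fin n → Fin n → Set} {f g : Fin n → Fin n} {x y} → g ≗ f →
         (∃₂ λ a b → f a ≡ x × f b ≡ y × P a b) → ∃₂ λ a b → g a ≡ x × g b ≡ y × P a b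
    go g≗f (a , b , fa , fb , p) = a , b , trans (g≗f a) fa , trans (g≗f b) fb , p

  module _ (f : Fin n → Fin n) where

    private
      V? : Decidable (λ y → ∃[ a ] f a ≡ y)
      V? y = any? λ a → f a ≟ y

      edge? : ∀ x → Decidable (Edge f x)
      edge? x y = ¬? (x ≟ y) ×-dec any? λ a → any? λ b → f a ≟ x ×-dec f b ≟ y ×-dec b ∈? G.nbhd a

      red? : ∀ x → Decidable (RedEdge f x)
      red? x y = edge? x y ×-dec any? λ a → any? λ b → f a ≟ x ×-dec f b ≟ y ×-dec ¬? (b ∈? G.nbhd a)

      edge-sym : ∀ {x y} → Edge f x y → Edge f y x
      edge-sym (x≢y , a , b , fa , fb , ab) = x≢y ∘ sym , b , a , fb , fa , G.symmetric ab

      red-sym : ∀ {x y} → RedEdge f x y → RedEdge f y x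
      red-sym (e , a , b , fa , fb , ¬ab) = edge-sym e , b , a , fb , fa , ¬ab ∘ G.symmetric

    quotient : Trigraph n
    quotient = record
      { V             = ⟦ V? ⟧
      ; nbhd          = λ x → ⟦ edge? x ⟧
      ; redNbhd       = λ x → ⟦ red? x ⟧
      ; nbhd⊆V        = λ {x} y∈ → let (_ , _ , b , _ , fb , _) = ∈⟦⟧⁻ (edge? x) y∈ in ∈⟦⟧⁺ V? (b , fb)
      ; redNbhd⊆nbhd  = λ {x} y∈ → ∈⟦⟧⁺ (edge? x) (proj₁ (∈⟦⟧⁻ (red? x) y∈))
      ; symmetric     = λ {x} {y} y∈ → ∈⟦⟧⁺ (edge? y) (edge-sym (∈⟦⟧⁻ (edge? x) y∈))
      ; red-symmetric = λ {x} {y} y∈ → ∈⟦⟧⁺ (red? y) (red-sym (∈⟦⟧⁻ (red? x) y∈))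
      ; irreflexive   = λ {x} x∈ → proj₁ (∈⟦⟧⁻ (edge? x) x∈) refl
      }

    quotient-isQuotient : IsQuotient f quotient
    quotient-isQuotient = record
      { V-image = mk⇔ (∈⟦⟧⁻ V?) (∈⟦⟧⁺ V?)
      ; nbhd⇔   = λ {x} → mk⇔ (∈⟦⟧⁻ (edge? x)) (∈⟦⟧⁺ (edge? x))
      ; red⇔    = λ {x} → mk⇔ (∈⟦⟧⁻ (red? x)) (∈⟦⟧⁺ (red? x))
      }

  module _ {f f′ h : Fin n → Fin n} {x₁ x₂ : Fin n}
           (x₁∈ : ∃[ a ] f a ≡ x₁) (x₂∈ : ∃[ a ] f a ≡ x₂) (x₁≢x₂ : x₁ ≢ x₂)
           (h-x₂ : h x₂ ≡ x₁) (h-fix : ∀ {y} → y ≢ x₂ → h y ≡ y) (f′≗ : f′ ≗ h ∘ f)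
           {T T′ : Trigraph n} (Q : IsQuotient f T) (Q′ : IsQuotient f′ T′) where

    private
      module T = Trigraph T
      module T′ = Trigraph T′

      pair : Subset n
      pair = ⁅ x₁ ⁆ ∪ ⁅ x₂ ⁆

      ∉pair⁺ : ∀ {y} → y ≢ x₁ → y ≢ x₂ → y ∉ pair
      ∉pair⁺ y≢x₁ y≢x₂ y∈ with x∈p∪q⁻ ⁅ x₁ ⁆ ⁅ x₂ ⁆ y∈
      ... | inj₁ y∈₁ = y≢x₁ (x∈⁅y⁆⇒x≡y x₁ y∈₁)
      ... | inj₂ y∈₂ = y≢x₂ (x∈⁅y⁆⇒x≡y x₂ y∈₂)

      x₁∈pair : x₁ ∈ pair
      x₁∈pair = x∈p∪q⁺ (inj₁ (x∈⁅x⁆ x₁))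

      ∉pair⁻ : ∀ {y} → y ∉ pair → y ≢ x₁ × y ≢ x₂
      ∉pair⁻ y∉ = (λ { refl → y∉ x₁∈pair }) ,
                  (λ { refl → y∉ (x∈p∪q⁺ (inj₂ (x∈⁅x⁆ x₂))) })

      f′≡x₁⁺ : ∀ {a} → f a ≡ x₁ ⊎ f a ≡ x₂ → f′ a ≡ x₁
      f′≡x₁⁺ {a} (inj₁ fa) = trans (f′≗ a) (trans (cong h fa) (h-fix x₁≢x₂))
      f′≡x₁⁺ {a} (inj₂ fa) = trans (f′≗ a) (trans (cong h fa) h-x₂)

      f′≡x₁⁻ : ∀ {a} → f′ a ≡ x₁ → f a ≡ x₁ ⊎ f a ≡ x₂
      f′≡x₁⁻ {a} f′a with f a ≟ x₂
      ... | yes fa  = inj₂ fa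
      ... | no  fa≢ = inj₁ (trans (sym (h-fix fa≢)) (trans (sym (f′≗ a)) f′a))

      other⁺ : ∀ {a y} → y ≢ x₂ → f a ≡ y → f′ a ≡ y
      other⁺ {a} y≢x₂ fa = trans (f′≗ a) (trans (cong h fa) (h-fix y≢x₂))

      other⁻ : ∀ {a y} → y ≢ x₁ → f′ a ≡ y → f a ≡ y
      other⁻ {a} y≢x₁ f′a with f a ≟ x₂
      ... | yes fa  = contradiction (trans (sym f′a) (f′≡x₁⁺ (inj₂ fa))) y≢x₁
      ... | no  fa≢ = trans (sym (h-fix fa≢)) (trans (sym (f′≗ a)) f′a)

      -- With `Adj G` for `P` this is `Adjacent`, with its negation `NonAdjacent`, so the four
      -- transfer lemmas below serve edges and red edges alike.
      Related : (Fin n → Fin n → Set) → (Fin n → Fin n) → Fin n → Fin n → Set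
      Related P g x y = ∃₂ λ a b → g a ≡ x × g b ≡ y × P a b

      merged⁻ : ∀ {P y} → y ≢ x₁ → Related P f′ x₁ y → Related P f x₁ y ⊎ Related P f x₂ y
      merged⁻ y≢x₁ (a , b , f′a , f′b , p) with f′≡x₁⁻ f′a
      ... | inj₁ fa = inj₁ (a , b , fa , other⁻ y≢x₁ f′b , p)
      ... | inj₂ fa = inj₂ (a , b , fa , other⁻ y≢x₁ f′b , p)

      merged⁺ : ∀ {P y} → y ≢ x₂ → Related P f x₁ y ⊎ Related P f x₂ y → Related P f′ x₁ y
      merged⁺ y≢x₂ (inj₁ (a , b , fa , fb , p)) = a , b , f′≡x₁⁺ (inj₁ fa) , other⁺ y≢x₂ fb , p
      merged⁺ y≢x₂ (inj₂ (a , b , fa , fb , p)) = a , b , f′≡x₁⁺ (inj₂ fa) , other⁺ y≢x₂ fb , p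

      others⁻ : ∀ {P x y} → x ≢ x₁ → y ≢ x₁ → Related P f′ x y → Related P f x y
      others⁻ x≢x₁ y≢x₁ (a , b , f′a , f′b , p) = a , b , other⁻ x≢x₁ f′a , other⁻ y≢x₁ f′b , p

      others⁺ : ∀ {P x y} → x ≢ x₂ → y ≢ x₂ → Related P f x y → Related P f′ x y
      others⁺ x≢x₂ y≢x₂ (a , b , fa , fb , p) = a , b , other⁺ x≢x₂ fa , other⁺ y≢x₂ fb , p

      V-eq : T′.V ≡ (T.V ─ pair) ∪ ⁅ x₁ ⁆
      V-eq = ⊆-antisym ⊆₁ ⊆₂
        where
        ⊆₁ : T′.V ⊆ (T.V ─ pair) ∪ ⁅ x₁ ⁆
        ⊆₁ {y} y∈ with y ≟ x₁ | to (V-image Q′) y∈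
        ... | yes refl | _       = x∈p∪q⁺ (inj₂ (x∈⁅x⁆ x₁))
        ... | no y≢x₁  | a , f′a = x∈p∪q⁺ (inj₁ (x∈p∧x∉q⇒x∈p─q
                (from (V-image Q) (a , fa)) (∉pair⁺ y≢x₁ y≢x₂)))
          where
          fa : f a ≡ y
          fa = other⁻ y≢x₁ f′a
          y≢x₂ : y ≢ x₂
          y≢x₂ y≡x₂ = y≢x₁ (trans (sym f′a) (f′≡x₁⁺ (inj₂ (trans fa y≡x₂))))
        ⊆₂ : (T.V ─ pair) ∪ ⁅ x₁ ⁆ ⊆ T′.V
        ⊆₂ {y} y∈ with x∈p∪q⁻ (T.V ─ pair) ⁅ x₁ ⁆ y∈
        ... | inj₁ y∈rest = let (a , fa) = to (V-image Q) (p─q⊆p T.V pair y∈rest) in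
                from (V-image Q′) (a , other⁺ (proj₂ (∉pair⁻ (x∈p─q⇒x∉q y∈rest))) fa)
        ... | inj₂ y∈x₁ with refl ← x∈⁅y⁆⇒x≡y x₁ y∈x₁ =
                from (V-image Q′) (proj₁ x₁∈ , f′≡x₁⁺ (inj₁ (proj₂ x₁∈)))

      -- Whatever `f` sends to `x₂`, `f′` sends to `x₁`, so `x₂` has left the image of `f′` and
      -- cannot be an endpoint.
      ∉x₂ : ∀ {y} → y ∈ T′.nbhd x₁ → y ≢ x₂
      ∉x₂ y∈ refl with to (nbhd⇔ Q′) y∈
      ... | x₁≢x₂ , _ , b , _ , f′b , _ =
              x₁≢x₂ (trans (sym (f′≡x₁⁺ (inj₂ (other⁻ (x₁≢x₂ ∘ sym) f′b)))) f′b)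

      nbhd-eq : T′.nbhd x₁ ≡ (T.nbhd x₁ ∪ T.nbhd x₂) ─ pair
      nbhd-eq = ⊆-antisym ⊆₁ ⊆₂
        where
        ⊆₁ : T′.nbhd x₁ ⊆ (T.nbhd x₁ ∪ T.nbhd x₂) ─ pair
        ⊆₁ {y} y∈ = let (x₁≢y , r) = to (nbhd⇔ Q′) y∈ in
          x∈p∧x∉q⇒x∈p─q
            (x∈p∪q⁺ (Sum.map (λ r → from (nbhd⇔ Q) (x₁≢y , r))
                         (λ r → from (nbhd⇔ Q) (∉x₂ y∈ ∘ sym , r)) (merged⁻ (x₁≢y ∘ sym) r)))
            (∉pair⁺ (x₁≢y ∘ sym) (∉x₂ y∈))
        ⊆₂ : (T.nbhd x₁ ∪ T.nbhd x₂) ─ pair ⊆ T′.nbhd x₁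
        ⊆₂ {y} y∈ = let (y≢x₁ , y≢x₂) = ∉pair⁻ (x∈p─q⇒x∉q y∈) in
          from (nbhd⇔ Q′) (y≢x₁ ∘ sym , merged⁺ y≢x₂
            (Sum.map (proj₂ ∘ to (nbhd⇔ Q)) (proj₂ ∘ to (nbhd⇔ Q))
              (x∈p∪q⁻ (T.nbhd x₁) (T.nbhd x₂) (p─q⊆p _ pair y∈))))

      -- A red edge at the merged vertex needs a non-adjacent pair of preimages. If `y` was a
      -- neighbour of only one of `x₁` and `x₂`, the other class supplies that pair: this is the
      -- symmetric difference. If `y` was a neighbour of both, the pair lies over one of them, whose
      -- edge to `y` was red already.
      red-eq : T′.redNbhd x₁ ≡
               ((T.redNbhd x₁ ∪ T.redNbhd x₂) ∪ (T.nbhd x₁ △ T.nbhd x₂)) ─ pair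
      red-eq = ⊆-antisym ⊆₁ ⊆₂
        where
        ⊆₁ : T′.redNbhd x₁ ⊆ ((T.redNbhd x₁ ∪ T.redNbhd x₂) ∪ (T.nbhd x₁ △ T.nbhd x₂)) ─ pair
        ⊆₁ {y} y∈ = x∈p∧x∉q⇒x∈p─q (cases (y ∈? T.nbhd x₁) (y ∈? T.nbhd x₂)) (∉pair⁺ y≢x₁ y≢x₂)
          where
          e = to (red⇔ Q′) y∈
          y≢x₁ : y ≢ x₁
          y≢x₁ = proj₁ (proj₁ e) ∘ sym
          y≢x₂ : y ≢ x₂
          y≢x₂ = ∉x₂ (T′.redNbhd⊆nbhd y∈)
          cases : Dec (y ∈ T.nbhd x₁) → Dec (y ∈ T.nbhd x₂) →
                  y ∈ (T.redNbhd x₁ ∪ T.redNbhd x₂) ∪ (T.nbhd x₁ △ T.nbhd x₂)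
          cases (yes y∈₁) (no y∉₂)  = x∈p∪q⁺ (inj₂ (x∈p∪q⁺ (inj₁ (x∈p∧x∉q⇒x∈p─q y∈₁ y∉₂))))
          cases (no y∉₁)  (yes y∈₂) = x∈p∪q⁺ (inj₂ (x∈p∪q⁺ (inj₂ (x∈p∧x∉q⇒x∈p─q y∈₂ y∉₁))))
          cases (no y∉₁)  (no y∉₂)  with merged⁻ y≢x₁ (proj₂ (proj₁ e))
          ... | inj₁ r = contradiction (from (nbhd⇔ Q) (y≢x₁ ∘ sym , r)) y∉₁
          ... | inj₂ r = contradiction (from (nbhd⇔ Q) (y≢x₂ ∘ sym , r)) y∉₂
          cases (yes y∈₁) (yes y∈₂) = x∈p∪q⁺ (inj₁ (x∈p∪q⁺
            (Sum.map (λ r → from (red⇔ Q) (to (nbhd⇔ Q) y∈₁ , r))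
                               (λ r → from (red⇔ Q) (to (nbhd⇔ Q) y∈₂ , r))
                               (merged⁻ y≢x₁ (proj₂ e)))))
        ⊆₂ : ((T.redNbhd x₁ ∪ T.redNbhd x₂) ∪ (T.nbhd x₁ △ T.nbhd x₂)) ─ pair ⊆ T′.redNbhd x₁
        ⊆₂ {y} y∈ with x∈p∪q⁻ (T.redNbhd x₁ ∪ T.redNbhd x₂) _ (p─q⊆p _ pair y∈)
                  | ∉pair⁻ (x∈p─q⇒x∉q y∈)
        ... | inj₁ y∈red | y≢x₁ , y≢x₂ = from (red⇔ Q′) ((y≢x₁ ∘ sym , merged⁺ y≢x₂ edges) , merged⁺ y≢x₂ nonEdges)
          where
          which = Sum.map (to (red⇔ Q)) (to (red⇔ Q)) (x∈p∪q⁻ (T.redNbhd x₁) _ y∈red)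
          edges = Sum.map (proj₂ ∘ proj₁) (proj₂ ∘ proj₁) which
          nonEdges = Sum.map proj₂ proj₂ which
        ... | inj₂ y∈△ | y≢x₁ , y≢x₂ with x∈p∪q⁻ (T.nbhd x₁ ─ T.nbhd x₂) _ y∈△
        ...   | inj₁ y∈₁ = from (red⇔ Q′)
                  ((y≢x₁ ∘ sym , merged⁺ y≢x₂ (inj₁ (a , b , fa , fb , ab)))
                  -- `y` is no neighbour of `x₂`, so any preimage of `x₂` is non-adjacent to `b`,
                  -- and `x₂∈` provides one.
                  , merged⁺ y≢x₂ (inj₂ (proj₁ x₂∈ , b , proj₂ x₂∈ , fb ,
                      λ adj → x∈p─q⇒x∉q y∈₁ (from (nbhd⇔ Q) (y≢x₂ ∘ sym , _ , _ , proj₂ x₂∈ , fb , adj)))))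
          where
          r = proj₂ (to (nbhd⇔ Q) (p─q⊆p _ _ y∈₁))
          a = proj₁ r
          b = proj₁ (proj₂ r)
          fa = proj₁ (proj₂ (proj₂ r))
          fb = proj₁ (proj₂ (proj₂ (proj₂ r)))
          ab = proj₂ (proj₂ (proj₂ (proj₂ r)))
        ...   | inj₂ y∈₂ = from (red⇔ Q′)
                  ((y≢x₁ ∘ sym , merged⁺ y≢x₂ (inj₂ (a , b , fa , fb , ab)))
                  , merged⁺ y≢x₂ (inj₁ (proj₁ x₁∈ , b , proj₂ x₁∈ , fb ,
                      λ adj → x∈p─q⇒x∉q y∈₂ (from (nbhd⇔ Q) (y≢x₁ ∘ sym , _ , _ , proj₂ x₁∈ , fb , adj)))))
          where
          r = proj₂ (to (nbhd⇔ Q) (p─q⊆p _ _ y∈₂))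
          a = proj₁ r
          b = proj₁ (proj₂ r)
          fa = proj₁ (proj₂ (proj₂ r))
          fb = proj₁ (proj₂ (proj₂ (proj₂ r)))
          ab = proj₂ (proj₂ (proj₂ (proj₂ r)))

      ∉rest : ∀ {u} → u ∈ T.V ─ pair → u ≢ x₁ × u ≢ x₂
      ∉rest u∈ = ∉pair⁻ (x∈p─q⇒x∉q u∈)

      nbhd-others : ∀ {u v} → u ∈ T.V ─ pair → v ∈ T.V ─ pair → v ∈ T′.nbhd u ⇔ v ∈ T.nbhd u
      nbhd-others u∈ v∈ = let (u≢x₁ , u≢x₂) = ∉rest u∈ ; (v≢x₁ , v≢x₂) = ∉rest v∈ in mk⇔
        (λ v∈′ → let (u≢v , r) = to (nbhd⇔ Q′) v∈′ in from (nbhd⇔ Q) (u≢v , others⁻ u≢x₁ v≢x₁ r))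
        (λ v∈′ → let (u≢v , r) = to (nbhd⇔ Q) v∈′ in from (nbhd⇔ Q′) (u≢v , others⁺ u≢x₂ v≢x₂ r))

      red-others : ∀ {u v} → u ∈ T.V ─ pair → v ∈ T.V ─ pair → v ∈ T′.redNbhd u ⇔ v ∈ T.redNbhd u
      red-others u∈ v∈ = let (u≢x₁ , u≢x₂) = ∉rest u∈ ; (v≢x₁ , v≢x₂) = ∉rest v∈ in mk⇔
        (λ v∈′ → let ((u≢v , r) , s) = to (red⇔ Q′) v∈′ in
          from (red⇔ Q) ((u≢v , others⁻ u≢x₁ v≢x₁ r) , others⁻ u≢x₁ v≢x₁ s))
        (λ v∈′ → let ((u≢v , r) , s) = to (red⇔ Q) v∈′ in
          from (red⇔ Q′) ((u≢v , others⁺ u≢x₂ v≢x₂ r) , others⁺ u≢x₂ v≢x₂ s))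

    -- `h` only moves `x₂` to `x₁`, so passing from `f` to `f′` merges these two classes and leaves
    -- all others alone; `x₁` serves as the label of the new vertex.
    contract : Contraction T T′
    contract = record
      { x₁ = x₁ ; x₂ = x₂ ; x₀ = x₁
      ; x₁∈V = from (V-image Q) x₁∈
      ; x₂∈V = from (V-image Q) x₂∈
      ; x₁≢x₂ = x₁≢x₂
      ; x₀∉rest = λ x₁∈rest → x∈p─q⇒x∉q x₁∈rest x₁∈pair
      ; V-eq = V-eq
      ; nbhd-x₀ = nbhd-eq
      ; redNbhd-x₀ = red-eq
      ; nbhd-rest = nbhd-others
      ; redNbhd-rest = red-others
      }

  RedDegree≤ : ℕ → (Fin n → Fin n) → Set
  RedDegree≤ k f = ∀ x → ∃[ ys ] length ys ≤ k × (∀ {y} → RedEdge f x y → y ∈ˡ ys)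

  -- Quantifying over all `T` avoids comparing trigraphs for equality: the sequence starts at
  -- `toTrigraph G`, which is a quotient along `id` but is not built by `quotient`.
  Contractible : ℕ → (Fin n → Fin n) → Set
  Contractible k f = ∀ {T} → IsQuotient f T → ∃[ s ] seqWidth {G = T} s ≤ k

  maxRedDegree-quotient : ∀ {k f T} → RedDegree≤ k f → IsQuotient f T → maxRedDegree T ≤ k
  maxRedDegree-quotient {T = T} bound Q = maxRedDegree≤ T λ x → let (ys , len , ⊆ys) = bound x in
    ≤-trans (∣p∣≤length ys (⊆ys ∘ to (red⇔ Q))) len

  contractible-resp-≗ : ∀ {k f g} → f ≗ g → Contractible k g → Contractible k f
  contractible-resp-≗ f≗g C Q = C (IsQuotient-resp-≗ f≗g Q)

  -- A single class is one vertex without edges, where the sequence ends. The argument of type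
  -- `Fin n` makes the class inhabited.
  constant-contractible : ∀ {k f x} → (∀ a → f a ≡ x) → Fin n → Contractible k f
  constant-contractible {k} {f} {x} const a {T} Q =
    single (trans (cong ∣_∣ V≡) (∣⁅x⁆∣≡1 x)) , maxRedDegree-quotient noRed Q
    where
    V≡ : Trigraph.V T ≡ ⁅ x ⁆
    V≡ = ⊆-antisym
      (λ y∈ → let (b , fb) = to (V-image Q) y∈ in subst (_∈ ⁅ x ⁆) (trans (sym (const b)) fb) (x∈⁅x⁆ x))
      (λ y∈ → from (V-image Q) (a , trans (const a) (sym (x∈⁅y⁆⇒x≡y x y∈))))
    noRed : RedDegree≤ k f
    noRed y = [] , z≤n , λ ((y≢z , a , b , fa , fb , _) , _) →
      contradiction (trans (sym fa) (trans (const a) (trans (sym (const b)) fb))) y≢z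

  -- If f does not hit x₂, or if x₁ ≡ x₂, nothing is contracted.
  step-contractible : ∀ {k f f′ h x₁ x₂} → RedDegree≤ k f → (∃[ a ] f a ≡ x₁) →
    h x₂ ≡ x₁ → (∀ {y} → y ≢ x₂ → h y ≡ y) → f′ ≗ h ∘ f → Contractible k f′ → Contractible k f
  step-contractible {f = f} {f′} {h} {x₁} {x₂} bound x₁∈ h-x₂ h-fix f′≗ C
    with any? (λ a → f a ≟ x₂) | x₁ ≟ x₂
  ... | yes x₂∈ | no x₁≢x₂ = λ Q →
    let Q′ = quotient-isQuotient f′
        (s , width≤) = C Q′
    in step (contract x₁∈ x₂∈ x₁≢x₂ h-x₂ h-fix f′≗ Q Q′) s , ⊔-lub (maxRedDegree-quotient bound Q) width≤
  ... | no x₂∉ | _ = contractible-resp-≗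
    (λ a → sym (trans (f′≗ a) (h-fix λ fa → x₂∉ (a , fa)))) C
  ... | yes _ | yes refl = contractible-resp-≗ (λ a → sym (trans (f′≗ a) (fixed (f a)))) C
    where
    fixed : ∀ y → h y ≡ y
    fixed y with y ≟ x₁
    ... | yes refl = h-x₂
    ... | no  y≢   = h-fix y≢

-- Acyclic graphs and connected sets of nodes of a tree

minimiser : ∀ {m} {P : Fin m → Set} → Decidable P → (rank : Fin m → ℕ) → ∃[ x ] P x →
            ∃[ x ] P x × (∀ {y} → P y → rank x ≤ rank y)
minimiser {m} {P} P? rank (x , Px) = <-rec Goal search (rank x) x Px refl
  where
  Goal : ℕ → Set
  Goal r = ∀ x → P x → rank x ≡ r → ∃[ x ] P x × (∀ {y} → P y → rank x ≤ rank y)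
  search : ∀ r → (∀ {r′} → r′ < r → Goal r′) → Goal r
  search r rec x Px refl with any? (λ y → P? y ×-dec rank y <? rank x)
  ... | yes (y , Py , y<x) = rec y<x y Py refl
  ... | no  none           = x , Px , λ Py → ≮⇒≥ λ y<x → none (_ , Py , y<x)

module _ {m} (T : Graph m) where

  private module T = Graph T

  -- The first repetition of a walk without backtracking closes a cycle.
  nonBacktracking⇒cycle : (a : ℕ → Fin m) → (∀ i → Adj T (a i) (a (suc i))) →
                          (∀ i → a (2 + i) ≢ a i) → Cycle T
  nonBacktracking⇒cycle a adj noBack with pigeonhole (n<1+n m) (a ∘ toℕ)
  ... | i , j , i<j , ai≡aj = <-rec Goal close (toℕ j) (toℕ i , i<j , ai≡aj)
    where
    Repeats : ℕ → Set
    Repeats j = ∃[ i ] i < j × a i ≡ a j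
    repeats? : Decidable Repeats
    repeats? j = anyUpTo? (λ i → a i ≟ a j) j
    Goal : ℕ → Set
    Goal j = Repeats j → Cycle T
    cycle : ∀ i k → a i ≡ a (3 + k + i) → (∀ {j} → j < 3 + k + i → ¬ Repeats j) → Cycle T
    cycle i k eq first = record
      { c = c
      ; injective = inj
      ; adjacent = λ x → subst (λ t → Adj T (a (t + i)) (a (suc (toℕ x) + i))) (sym (toℕ-inject₁ x)) (adj _)
      ; closing = subst₂ (λ t y → Adj T (a (t + i)) y) (sym (toℕ-fromℕ (2 + k))) (sym eq) (adj _)
      }
      where
      c : Fin (3 + k) → Fin m
      c x = a (toℕ x + i)
      distinct : ∀ {x y} → toℕ x < toℕ y → c x ≢ c y
      distinct {x} {y} x<y cx≡cy = first (+-monoˡ-< i (toℕ<n y)) (_ , +-monoˡ-< i x<y , cx≡cy)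
      inj : Injective _≡_ _≡_ c
      inj {x} {y} cx≡cy with <-cmp (toℕ x) (toℕ y)
      ... | tri< x<y _ _ = contradiction cx≡cy (distinct x<y)
      ... | tri≈ _ x≡y _ = toℕ-injective x≡y
      ... | tri> _ _ y<x = contradiction (sym cx≡cy) (distinct y<x)
    close : ∀ j → (∀ {j′} → j′ < j → Goal j′) → Goal j
    close j rec (i , i<j , eq) with anyUpTo? repeats? j
    ... | yes (j′ , j′<j , r) = rec j′<j r
    ... | no  none with m≤n⇒∃[o]m+o≡n i<j
    ...   | d , i+d≡j with d | trans (cong suc (+-comm d i)) i+d≡j
    -- The walk returns after `suc d` steps: one step would be a loop, two a backtracking, and more
    -- give a cycle.
    ...   | zero        | refl = contradiction (subst (λ y → Adj T y (a (suc i))) eq (adj i)) T.irreflexive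
    ...   | suc zero    | refl = contradiction (sym eq) (noBack i)
    ...   | suc (suc k) | refl = cycle i k eq λ j′<j r → none (_ , j′<j , r)

  -- Degree at most one inside `P`, so isolated vertices count as leaves. The curried form makes it
  -- decidable by `all?` and `→-dec`.
  Leaf : Subset m → Fin m → Set
  Leaf P x = ∀ y → y ∈ P → Adj T x y → ∀ z → z ∈ P → Adj T x z → y ≡ z

  leaf? : ∀ P → Decidable (Leaf P)
  leaf? P x = all? λ y → y ∈? P →-dec y ∈? T.nbhd x →-dec all? λ z →
    z ∈? P →-dec z ∈? T.nbhd x →-dec y ≟ z

  -- If every vertex of `P` had two neighbours in `P`, a walk could go on forever without turning
  -- back, and such a walk closes a cycle.
  leaf : ¬ Cycle T → ∀ {P : Subset m} → (∃[ x ] x ∈ P) →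
         ∃[ x ] x ∈ P × Leaf P x
  leaf acyclic {P} (x₀ , x₀∈P) with any? (λ x → x ∈? P ×-dec leaf? P x)
  ... | yes found = found
  ... | no  none  = contradiction (nonBacktracking⇒cycle (cur ∘ state) (λ i → adj (state (suc i))) λ i → turns (state (suc i))) acyclic
    where
    continue : ∀ x → x ∈ P → ∀ p → ∃[ y ] y ∈ P × Adj T x y × y ≢ p
    continue x x∈P p with any? (λ y → y ∈? P ×-dec y ∈? T.nbhd x ×-dec ¬? (y ≟ p))
    ... | yes found = found
    ... | no  none′ = contradiction (x , x∈P , λ y y∈ xy z z∈ xz → trans (isP y y∈ xy) (sym (isP z z∈ xz))) none
      where
      isP : ∀ y → y ∈ P → Adj T x y → y ≡ p
      isP y y∈ xy with y ≟ p
      ... | yes y≡p = y≡p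
      ... | no  y≢p = contradiction (y , y∈ , xy , y≢p) none′

    record State : Set where
      field
        {prev cur} : Fin m
        cur∈P      : cur ∈ P
        adj        : Adj T prev cur
    open State

    next : State → State
    next s = let (_ , y∈ , xy , _) = continue (cur s) (cur∈P s) (prev s) in
      record { cur∈P = y∈ ; adj = xy }

    turns : ∀ s → cur (next s) ≢ prev s
    turns s = let (_ , _ , _ , y≢p) = continue (cur s) (cur∈P s) (prev s) in y≢p

    state : ℕ → State
    -- The walk has no previous vertex at the start. `x₀` stands in for it, which excludes no
    -- neighbour since there are no loops.
    state zero    = let (_ , y∈ , xy , _) = continue x₀ x₀∈P x₀ in record { cur∈P = y∈ ; adj = xy }
    state (suc i) = next (state i)

  Parent : (Fin m → ℕ) → Fin m → Fin m → Set
  Parent rank x y = Adj T x y × rank y < rank x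

  -- Removing leaves one at a time orders an acyclic graph so that every vertex
  -- has at most one lower neighbour, its parent.
  record Ordering (P : Subset m) (k : ℕ) : Set where
    field
      rank      : Fin m → ℕ
      rank<     : ∀ {x} → x ∈ P → rank x < k
      injective : ∀ {x y} → x ∈ P → y ∈ P → rank x ≡ rank y → x ≡ y
      unique    : ∀ {x y z} → x ∈ P → y ∈ P → z ∈ P → Parent rank x y → Parent rank x z → y ≡ z

  ordering : ¬ Cycle T → ∀ k (P : Subset m) → ∣ P ∣ ≤ k → Ordering P k
  ordering acyclic k P ∣P∣≤k with nonempty? P
  ... | no  empty = record
    { rank      = λ _ → 0
    ; rank<     = λ x∈P → contradiction (_ , x∈P) empty
    ; injective = λ x∈P → contradiction (_ , x∈P) empty
    ; unique    = λ x∈P → contradiction (_ , x∈P) empty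
    }
  ordering acyclic zero P ∣P∣≤0 | yes (x , x∈P) with () ← ≤-trans (x∈p⇒∣p-x∣<∣p∣ x∈P) ∣P∣≤0
  ordering acyclic (suc k) P ∣P∣≤k | yes nonEmpty with leaf acyclic nonEmpty
  ... | l , l∈P , isLeaf = record
    { rank      = rank
    ; rank<     = rank<
    ; injective = injective
    ; unique    = unique
    }
    where
    module O = Ordering (ordering acyclic k (P - l) (≤-pred (≤-trans (x∈p⇒∣p-x∣<∣p∣ l∈P) ∣P∣≤k)))
    rank : Fin m → ℕ
    rank x with x ≟ l
    -- The removed leaf ranks above all the rest: it is nobody's parent, and being a leaf it has at
    -- most one parent itself.
    ... | yes _ = k
    ... | no  _ = O.rank x
    rank< : ∀ {x} → x ∈ P → rank x < suc k
    rank< {x} x∈P with x ≟ l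
    ... | yes _   = ≤-refl
    ... | no  x≢l = m<n⇒m<1+n (O.rank< (x∈p∧x≢y⇒x∈p-y x∈P x≢l))
    injective : ∀ {x y} → x ∈ P → y ∈ P → rank x ≡ rank y → x ≡ y
    injective {x} {y} x∈P y∈P eq with x ≟ l | y ≟ l
    ... | yes x≡l | yes y≡l = trans x≡l (sym y≡l)
    ... | yes _   | no  y≢l = contradiction (sym eq) (<⇒≢ (O.rank< (x∈p∧x≢y⇒x∈p-y y∈P y≢l)))
    ... | no  x≢l | yes _   = contradiction eq (<⇒≢ (O.rank< (x∈p∧x≢y⇒x∈p-y x∈P x≢l)))
    ... | no  x≢l | no  y≢l = O.injective (x∈p∧x≢y⇒x∈p-y x∈P x≢l) (x∈p∧x≢y⇒x∈p-y y∈P y≢l) eq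
    unique : ∀ {x y z} → x ∈ P → y ∈ P → z ∈ P → Parent rank x y → Parent rank x z → y ≡ z
    unique {x} {y} {z} x∈P y∈P z∈P (xy , y<x) (xz , z<x) with x ≟ l | y ≟ l | z ≟ l
    ... | yes refl | _ | _ = isLeaf y y∈P xy z z∈P xz
    ... | no  x≢l  | yes _ | _ = contradiction (O.rank< (x∈p∧x≢y⇒x∈p-y x∈P x≢l)) (<-asym y<x)
    ... | no  x≢l  | no  _ | yes _ = contradiction (O.rank< (x∈p∧x≢y⇒x∈p-y x∈P x≢l)) (<-asym z<x)
    ... | no  x≢l  | no  y≢l | no z≢l = O.unique (x∈p∧x≢y⇒x∈p-y x∈P x≢l) (x∈p∧x≢y⇒x∈p-y y∈P y≢l)
            (x∈p∧x≢y⇒x∈p-y z∈P z≢l) (xy , y<x) (xz , z<x)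

  module _ (rank : Fin m → ℕ) (rank-injective : Injective _≡_ _≡_ rank)
           (parent-unique : ∀ {x y z} → Parent rank x y → Parent rank x z → y ≡ z) where

    private
      Up : Fin m → Fin m → Set
      Up = Parent rank

      descends : ∀ {x y} → Star Up y x → rank x ≤ rank y
      descends ε                 = ≤-refl
      descends ((_ , lt) ◅ rest) = ≤-trans (descends rest) (<⇒≤ lt)

      -- A walk can leave the descendants of x only through the parent of x.
      exit : ∀ {S : Fin m → Set} {x y z} → Star Up y x →
             Star (λ u v → S u × S v × Adj T u v) y z →
             (∃[ p ] Up x p × S p) ⊎ rank x ≤ rank z
      exit y↑x ε = inj₂ (descends y↑x)
      exit {y = y} y↑x (_◅_ {j = w} (Sy , Sw , yw) walk) with <-cmp (rank y) (rank w)
      ... | tri< y<w _ _ = exit ((T.symmetric yw , y<w) ◅ y↑x) walk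
      ... | tri≈ _ y≡w _ with refl ← rank-injective y≡w = contradiction yw T.irreflexive
      exit ε (_◅_ {j = w} (Sy , Sw , yw) walk) | tri> _ _ w<y = inj₁ (w , (yw , w<y) , Sw)
      exit (y↑u ◅ u↑x) (_◅_ {j = w} (Sy , Sw , yw) walk) | tri> _ _ w<y
        with refl ← parent-unique y↑u (yw , w<y) = exit u↑x walk

      -- Descendants of `x` never rank below `x`, so the walk in `S` from `x` to the lower node `y`
      -- has to leave them, through the parent of `x`.
      parent-in : ∀ {S : Fin m → Set} → ConnectedOn T S → ∀ {x y} → S x → S y → rank y < rank x →
                  ∃[ p ] Up x p × S p
      parent-in conn Sx Sy y<x with exit ε (conn Sx Sy)
      ... | inj₁ found = found
      ... | inj₂ x≤y   = contradiction y<x (≤⇒≯ x≤y)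

      -- While the common node `s` is not `t`, both sets reach strictly below it, `S` at `t` and
      -- `S′` at `t′`, so both contain its unique parent. Passing to that parent lowers the rank,
      -- and the descent can stop only at `t`.
      climb : ∀ {S S′ : Fin m → Set} → ConnectedOn T S → ConnectedOn T S′ → ∀ {t t′} →
              S t → (∀ {s} → S s → rank t ≤ rank s) → S′ t′ → rank t′ ≤ rank t →
              ∀ {s} → S s → S′ s → S′ t
      climb {S} {S′} conn conn′ {t} {t′} St lowest S′t′ t′≤t {s} = <-rec Climbs body (rank s) s refl
        where
        Climbs : ℕ → Set
        Climbs r = ∀ s → rank s ≡ r → S s → S′ s → S′ t
        body : ∀ r → (∀ {r′} → r′ < r → Climbs r′) → Climbs r
        body r rec s refl Ss S′s with s ≟ t
        ... | yes refl = S′s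
        ... | no  s≢t  =
          let t<s = ≤∧≢⇒< (lowest Ss) (s≢t ∘ sym ∘ rank-injective)
              (p , s↑p , Sp)  = parent-in conn Ss St t<s
              (q , s↑q , S′q) = parent-in conn′ S′s S′t′ (≤-<-trans t′≤t t<s)
          in rec (proj₂ s↑p) p refl Sp (subst S′ (parent-unique s↑q s↑p) S′q)

    -- Choosing `v` with the highest lowest node puts the lowest node of every `B u` no higher than
    -- `t`, which is what `climb` asks for.
    simplicial-ordered : ∀ {h} (B : Fin (suc h) → Fin m → Set) → (∀ v → Decidable (B v)) →
      (∀ v → ∃[ t ] B v t) → (∀ v → ConnectedOn T (B v)) →
      ∃₂ λ v t → B v t × (∀ {u s} → B u s → B v s → B u t)
    simplicial-ordered {h} B B? nonEmpty connected = v , proj₁ (lowest v) , proj₁ (proj₂ (lowest v)) ,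
      λ {u} Bus Bvs → climb (connected v) (connected u)
        (proj₁ (proj₂ (lowest v))) (proj₂ (proj₂ (lowest v)))
        (proj₁ (proj₂ (lowest u))) (highest u) Bvs Bus
      where
      lowest : ∀ v → ∃[ t ] B v t × (∀ {s} → B v s → rank t ≤ rank s)
      lowest v = minimiser (B? v) rank (nonEmpty v)
      height : Fin (suc h) → ℕ
      height v = rank (proj₁ (lowest v))
      v : Fin (suc h)
      v = argmax height zero (allFin (suc h))
      highest : ∀ u → height u ≤ height v
      highest u = All.lookup (f[xs]≤f[argmax] {f = height} zero (allFin (suc h))) (∈-allFin u)

  -- Connected sets of nodes of a tree form a chordal intersection graph: the
  -- set whose lowest node is highest is simplicial.
  simplicial : ¬ Cycle T → ∀ {h} (B : Fin (suc h) → Fin m → Set) → (∀ v → Decidable (B v)) →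
    (∀ v → ∃[ t ] B v t) → (∀ v → ConnectedOn T (B v)) →
    ∃₂ λ v t → B v t × (∀ {u s} → B u s → B v s → B u t)
  simplicial acyclic = simplicial-ordered O.rank (O.injective ∈⊤ ∈⊤) (O.unique ∈⊤ ∈⊤ ∈⊤)
    where module O = Ordering (ordering acyclic m ⊤ (∣p∣≤n ⊤))

-- Tree-decompositions and minors

-- Adjacency in the minor of G whose branch sets are the fibres of label.
MinorAdj : ∀ {n h} → Graph n → (Fin n → Fin h) → Fin h → Fin h → Set
MinorAdj G label u v = ∃₂ λ x y → label x ≡ u × label y ≡ v × Adj G x y

module _ {n} {G : Graph n} (D : TreeDecomposition G) where
  open TreeDecomposition D

  -- When a branch set `P` is contracted to a vertex, a tree-decomposition of `G` becomes one of the
  -- minor, with that vertex at exactly these nodes.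
  Trace : (Fin n → Set) → Fin nodes → Set
  Trace P t = ∃[ x ] P x × x ∈ bag t

  trace? : ∀ {P} → Decidable P → Decidable (Trace P)
  trace? P? t = any? λ x → P? x ×-dec x ∈? bag t

  -- Follow a walk in `P`: the nodes of a single vertex are connected, and consecutive vertices
  -- share a bag because their edge is covered.
  trace-connected : ∀ {P} → ConnectedOn G P → ConnectedOn tree (Trace P)
  trace-connected {P} conn (x , Px , x∈) (y , Py , y∈) = along x∈ y∈ Px (conn Px Py)
    where
    _~_ : Fin nodes → Fin nodes → Set
    u ~ v = Trace P u × Trace P v × Adj tree u v
    along : ∀ {x y s t} → x ∈ bag s → y ∈ bag t → P x →
            Star (λ u v → P u × P v × Adj G u v) x y → Star _~_ s t
    along {x} x∈s x∈t Px ε = gmap id (λ (x∈u , x∈v , uv) → (x , Px , x∈u) , (x , Px , x∈v) , uv)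
      (bagsConnected x x∈s x∈t)
    along {x} x∈s y∈t Px ((_ , Pz , xz) ◅ walk) with edgeCovered xz
    ... | u , x∈u , z∈u = along x∈s x∈u Px ε ◅◅ along z∈u y∈t Pz walk

  width≥ : ∀ {k t} → suc k ≤ ∣ bag t ∣ → k ≤ width
  width≥ {k} {t} k<∣bag∣ = ∸-monoˡ-≤ 1 (≤-trans k<∣bag∣
    (v≤max⁺ 0 (map (λ t → ∣ bag t ∣) (allFin nodes)) (inj₂ (lose (∈-map⁺ _ (∈-allFin t)) ≤-refl))))

  module _ {h} (label : Fin n → Fin (suc h))
           (nonEmpty : ∀ v → ∃[ x ] label x ≡ v) (connected : ∀ v → ConnectedOn G (λ x → label x ≡ v)) where

    -- The bag covering an edge between two branch sets meets both, so adjacent branch sets have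
    -- intersecting traces and `simplicial` applies.
    simplicial-branchSet : ∃₂ λ v t → Trace (λ x → label x ≡ v) t ×
                           (∀ {u} → MinorAdj G label v u → Trace (λ x → label x ≡ u) t)
    simplicial-branchSet =
      let (v , t , v∈t , simp) = simplicial tree (IsTree.acyclic isTree) (λ v → Trace (λ x → label x ≡ v))
            (λ v → trace? (λ x → label x ≟ v)) traceNonEmpty (λ v → trace-connected (connected v))
      in v , t , v∈t , λ (x , y , x∈v , y∈u , xy) →
        let (s , x∈s , y∈s) = edgeCovered xy in simp (y , y∈u , y∈s) (x , x∈v , x∈s)
      where
      traceNonEmpty : ∀ v → ∃[ t ] Trace (λ x → label x ≡ v) t
      traceNonEmpty v = let (x , eq) = nonEmpty v ; (t , x∈t) = vertexCovered x in t , x , eq , x∈t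

    -- The bag of the simplicial branch set contains a vertex of it and one of each of `d`
    -- neighbouring branch sets. Their labels differ, so the bag has at least `suc d` elements.
    minorMinDegree≤width : ∀ {d} →
      (∀ v → Σ[ u ∈ (Fin d → Fin (suc h)) ] Injective _≡_ _≡_ u × (∀ k → u k ≢ v × MinorAdj G label v (u k))) →
      d ≤ width
    minorMinDegree≤width {d} neighbours =
      let (v , t , v∈t , simp)   = simplicial-branchSet
          (u , u-inj , u-nbr)    = neighbours v
      in bound u u-inj (proj₁ ∘ u-nbr) v∈t (simp ∘ proj₂ ∘ u-nbr)
      where
      bound : ∀ {v t} (u : Fin d → Fin (suc h)) → Injective _≡_ _≡_ u → (∀ k → u k ≢ v) →
              Trace (λ x → label x ≡ v) t → (∀ k → Trace (λ x → label x ≡ u k) t) → d ≤ width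
      bound {v} {t} u u-inj u≢v (x , x∈v , x∈t) meets = width≥ (injection⇒≤∣p∣ f f-inj f∈)
        where
        f : Fin (suc d) → Fin n
        f zero    = x
        f (suc k) = proj₁ (meets k)
        f∈ : ∀ k → f k ∈ bag t
        f∈ zero    = x∈t
        f∈ (suc k) = proj₂ (proj₂ (meets k))
        label-f : ∀ k → label (f (suc k)) ≡ u k
        label-f k = proj₁ (proj₂ (meets k))
        f-inj : Injective _≡_ _≡_ f
        f-inj {zero}  {zero}  eq = refl
        f-inj {zero}  {suc l} eq = contradiction (trans (sym (label-f l)) (trans (cong label (sym eq)) x∈v)) (u≢v l)
        f-inj {suc k} {zero}  eq = contradiction (trans (sym (label-f k)) (trans (cong label eq) x∈v)) (u≢v k)
        f-inj {suc k} {suc l} eq = cong suc (u-inj (trans (sym (label-f k)) (trans (cong label eq) (label-f l))))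

-- Neighbours and truncation on a path

Consecutive : ∀ {n} → Fin n → Fin n → Set
Consecutive j k = suc (toℕ j) ≡ toℕ k

pred-consecutive : ∀ {n} {j k : Fin n} → Consecutive j k → j ≡ pred k
pred-consecutive {k = suc k} eq = toℕ-injective (trans (ℕ.suc-injective eq) (sym (toℕ-inject₁ k)))

-- The successor, except that the last element is its own successor.
next : ∀ {n} → Fin n → Fin n
next {suc zero}    zero    = zero
next {suc (suc n)} zero    = suc zero
next {suc (suc n)} (suc j) = suc (next j)

next-consecutive : ∀ {n} {j k : Fin n} → Consecutive j k → k ≡ next j
next-consecutive {suc (suc n)} {zero}  {suc zero} eq = refl
next-consecutive {suc (suc n)} {suc j} {suc k}    eq = cong suc (next-consecutive (ℕ.suc-injective eq))

Near : ∀ {n} → Fin n → Fin n → Set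
Near j k = Consecutive j k ⊎ Consecutive k j

near : ∀ {n} {j k : Fin n} → Near j k → k ≡ pred j ⊎ k ≡ next j
near (inj₁ j→k) = inj₂ (next-consecutive j→k)
near (inj₂ k→j) = inj₁ (pred-consecutive k→j)

module _ {n : ℕ} where
  private
    same : ∀ {j k l : Fin n} → Consecutive j k → Consecutive j l → k ≡ l
    same j→k j→l = toℕ-injective (trans (sym j→k) j→l)

    same′ : ∀ {j k l : Fin n} → Consecutive j l → Consecutive k l → j ≡ k
    same′ j→l k→l = toℕ-injective (ℕ.suc-injective (trans j→l (sym k→l)))

    loop : ∀ {j k l i : Fin n} → Consecutive j k → Consecutive k l → Consecutive l i → ¬ Consecutive i j
    loop {j} jk kl li ij = m≢1+m+n (toℕ j) {3} (sym (trans (cong suc (+-comm (toℕ j) 3))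
      (trans (cong (3 +_) jk) (trans (cong (2 +_) kl) (trans (cong suc li) ij)))))

  -- If `k` and `l` lie on the same side of `j` or of `j′`, they coincide. Otherwise they lie on
  -- opposite sides of both: in the same order, this forces `j ≡ j′`; in reverse order, four
  -- successor steps would lead back to the start.
  near-injective : ∀ {j j′ k l : Fin n} → j ≢ j′ → Near j k → Near j l → Near j′ k → Near j′ l → k ≡ l
  near-injective j≢ (inj₁ jk) (inj₁ jl) _         _          = same jk jl
  near-injective j≢ (inj₂ kj) (inj₂ lj) _         _          = same′ kj lj
  near-injective j≢ _         _         (inj₁ j′k) (inj₁ j′l) = same j′k j′l
  near-injective j≢ _         _         (inj₂ kj′) (inj₂ lj′) = same′ kj′ lj′
  near-injective j≢ (inj₁ jk) (inj₂ lj) (inj₁ j′k) (inj₂ lj′) = contradiction (same′ jk j′k) j≢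
  near-injective j≢ (inj₂ kj) (inj₁ jl) (inj₂ kj′) (inj₁ j′l) = contradiction (same kj kj′) j≢
  near-injective j≢ (inj₁ jk) (inj₂ lj) (inj₂ kj′) (inj₁ j′l) = contradiction lj (loop jk kj′ j′l)
  near-injective j≢ (inj₂ kj) (inj₁ jl) (inj₁ j′k) (inj₂ lj′) = contradiction j′k (loop kj jl lj′)

-- The minimum of `s` and `j`, by recursion so that it stays in `Fin (suc n)`.
cap : ∀ {n} → ℕ → Fin (suc n) → Fin (suc n)
cap           zero    j       = zero
cap           (suc s) zero    = zero
cap {suc n}   (suc s) (suc j) = suc (cap s j)

cap-id : ∀ {n s} (j : Fin (suc n)) → toℕ j ≤ s → cap s j ≡ j
cap-id         {s = zero}  zero    _         = refl
cap-id         {s = suc s} zero    _         = refl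
cap-id {suc n} {s = suc s} (suc j) (s≤s j≤s) = cong suc (cap-id j j≤s)

cap-cap : ∀ {n} s (j : Fin (suc n)) → cap (suc s) (cap s j) ≡ cap s j
cap-cap         zero    j       = refl
cap-cap         (suc s) zero    = refl
cap-cap {suc n} (suc s) (suc j) = cong suc (cap-cap s j)

-- Together with `cap-below`: lowering the cap by one moves only the indices at the current end of
-- the path, so it amounts to a single contraction.
cap-top : ∀ {n} s (j : Fin (suc n)) → cap (suc s) j ≡ cap (suc s) (fromℕ n) → cap s j ≡ cap s (fromℕ n)
cap-top         zero    j       eq = refl
cap-top {zero}  (suc s) zero    eq = refl
cap-top {suc n} (suc s) (suc j) eq = cong suc (cap-top s j (Fin.suc-injective eq))

cap-below : ∀ {n} s (j : Fin (suc n)) → cap (suc s) j ≢ cap (suc s) (fromℕ n) → cap s j ≡ cap (suc s) j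
cap-below         zero    zero    _  = refl
cap-below         (suc s) zero    _  = refl
cap-below {suc n} zero    (suc j) ne = contradiction refl ne
cap-below {suc n} (suc s) (suc j) ne = cong suc (cap-below s j (ne ∘ cong suc))

cap-consecutive : ∀ {n} s {j k : Fin (suc n)} → Consecutive j k →
                  cap s j ≡ cap s k ⊎ Consecutive (cap s j) (cap s k)
cap-consecutive         zero                      eq = inj₁ refl
cap-consecutive {suc n} (suc zero)    {zero} {suc k} eq = inj₂ refl
cap-consecutive {suc n} (suc (suc s)) {zero} {suc zero} eq = inj₂ refl
cap-consecutive {suc n} (suc s) {suc j} {suc k} eq =
  Sum.map (cong suc) (cong suc) (cap-consecutive s (ℕ.suc-injective eq))

cap-near : ∀ {n} s {j k : Fin (suc n)} → Near j k → cap s j ≡ cap s k ⊎ Near (cap s j) (cap s k)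
cap-near s (inj₁ jk) = Sum.map₂ inj₁ (cap-consecutive s jk)
cap-near s (inj₂ kj) = Sum.map sym inj₂ (cap-consecutive s kj)

-- The graph of paths and hubs

-- Row zero holds the hubs, row suc i the vertices of the i-th path.
module Paths (M : ℕ) where

  N n : ℕ
  N = suc M
  n = suc N * N

  Cell : Set
  Cell = Fin (suc N) × Fin N

  abstract
    at : Cell → Fin n
    at = uncurry combine

    cell : Fin n → Cell
    cell = remQuot {suc N} N

    cell-at : ∀ u → cell (at u) ≡ u
    cell-at = uncurry remQuot-combine

    at-cell : ∀ x → at (cell x) ≡ x
    at-cell = combine-remQuot {suc N} N

    toℕ-at : ∀ i j → toℕ (at (i , j)) ≡ N * toℕ i + toℕ j
    toℕ-at = toℕ-combine

    at-monoˡ-< : ∀ {i i′} j → toℕ i < toℕ i′ → toℕ (at (i , j)) < toℕ (at (i′ , j))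
    at-monoˡ-< j = combine-monoˡ-< j j

  at-injective : ∀ {u v} → at u ≡ at v → u ≡ v
  at-injective {u} {v} eq = trans (sym (cell-at u)) (trans (cong cell eq) (cell-at v))

  cell-injective : ∀ {x y} → cell x ≡ cell y → x ≡ y
  cell-injective {x} {y} eq = trans (sym (at-cell x)) (trans (cong at eq) (at-cell y))

  data Link : Cell → Cell → Set where
    along : ∀ {i j k} → Near j k → Link (suc i , j) (suc i , k)
    spoke : ∀ {i j} → Link (zero , j) (suc i , j)
    spoke⁻¹ : ∀ {i j} → Link (suc i , j) (zero , j)

  link-sym : ∀ {u v} → Link u v → Link v u
  link-sym (along jk) = along (swap jk)
  link-sym spoke      = spoke⁻¹
  link-sym spoke⁻¹    = spoke

  link-irrefl : ∀ {u} → ¬ Link u u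
  link-irrefl (along (inj₁ jj)) = 1+n≢n jj
  link-irrefl (along (inj₂ jj)) = 1+n≢n jj

  link? : ∀ u v → Dec (Link u v)
  link? (zero , j) (zero , k) = no λ ()
  link? (zero , j) (suc i , k) with j ≟ k
  ... | yes refl = yes spoke
  ... | no  j≢k  = no λ { spoke → j≢k refl }
  link? (suc i , j) (zero , k) with j ≟ k
  ... | yes refl = yes spoke⁻¹
  ... | no  j≢k  = no λ { spoke⁻¹ → j≢k refl }
  link? (suc i , j) (suc i′ , k) with i ≟ i′ | (suc (toℕ j) ℕ.≟ toℕ k) ⊎-dec (suc (toℕ k) ℕ.≟ toℕ j)
  ... | yes refl | yes jk = yes (along jk)
  ... | yes refl | no ¬jk = no λ { (along jk) → ¬jk jk }
  ... | no i≢i′  | _      = no λ { (along _) → i≢i′ refl }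

  -- A column has one hub, and a row and a column meet in one cell; this settles every case with a
  -- hub. What remains is a 4-cycle within one path, excluded by `near-injective`.
  commonNeighbour-unique : ∀ {a b c d} → a ≢ b → Link a c → Link a d → Link b c → Link b d → c ≡ d
  commonNeighbour-unique a≢b spoke     spoke     spoke     spoke     = contradiction refl a≢b
  commonNeighbour-unique a≢b spoke     spoke     (along _) (along _) = refl
  commonNeighbour-unique a≢b (along _) (along _) spoke     spoke     = refl
  commonNeighbour-unique a≢b (along _) spoke⁻¹   (along _) spoke⁻¹   = contradiction refl a≢b
  commonNeighbour-unique a≢b spoke⁻¹   (along _) spoke⁻¹   (along _) = contradiction refl a≢b
  commonNeighbour-unique a≢b spoke⁻¹   spoke⁻¹   spoke⁻¹   spoke⁻¹   = refl
  commonNeighbour-unique a≢b (along jk) (along jl) (along j′k) (along j′l) =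
    cong (_ ,_) (near-injective (λ { refl → a≢b refl }) jk jl j′k j′l)

  G : Graph n
  G = record
    { nbhd        = λ x → ⟦ adj? x ⟧
    ; symmetric   = λ {x} {y} xy → ∈⟦⟧⁺ (adj? y) (link-sym (∈⟦⟧⁻ (adj? x) xy))
    ; irreflexive = λ {x} xx → link-irrefl (∈⟦⟧⁻ (adj? x) xx)
    }
    where
    adj? : ∀ x y → Dec (Link (cell x) (cell y))
    adj? x y = link? (cell x) (cell y)

  adj⇒link : ∀ x {y} → Adj G x y → Link (cell x) (cell y)
  adj⇒link x = ∈⟦⟧⁻ λ y → link? (cell x) (cell y)

  link⇒adj : ∀ x {y} → Link (cell x) (cell y) → Adj G x y
  link⇒adj x = ∈⟦⟧⁺ λ y → link? (cell x) (cell y)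

  link⇒adj-at : ∀ {u v} → Link u v → Adj G (at u) (at v)
  link⇒adj-at {u} {v} uv = link⇒adj (at u) (subst₂ Link (sym (cell-at u)) (sym (cell-at v)) uv)

  K₂₂⋢G : ¬ (K 2 2 ⊑ G)
  K₂₂⋢G (f , f-inj , f-hom) = contradiction
    -- `0F`, `1F` form one side of `K 2 2` and `2F`, `3F` the other, so `2F` and `3F` would have the
    -- same image.
    (f-inj (cell-injective (commonNeighbour-unique (λ eq → contradiction (f-inj (cell-injective eq)) λ ())
      (link 0F 2F refl) (link 0F 3F refl) (link 1F 2F refl) (link 1F 3F refl)))) λ ()
    where
    link : ∀ x y → lookup (Graph.nbhd (K 2 2) x) y ≡ true → Link (cell (f x)) (cell (f y))
    link x y eq = adj⇒link (f x) (f-hom {x} {y} (lookup⇒[]= y _ eq))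

  -- Twin-width at most 3

  open Quotient G

  lift : (Cell → Cell) → Fin n → Fin n
  lift g = at ∘ g ∘ cell

  RedLink : (Cell → Cell) → Cell → Cell → Set
  RedLink g u v = u ≢ v × (∃₂ λ a b → g a ≡ u × g b ≡ v × Link a b)
                        × (∃₂ λ a b → g a ≡ u × g b ≡ v × ¬ Link a b)

  redLink-sym : ∀ {g u v} → RedLink g u v → RedLink g v u
  redLink-sym (u≢v , (a , b , ga , gb , ab) , (a′ , b′ , ga′ , gb′ , ¬ab)) =
    u≢v ∘ sym , (b , a , gb , ga , link-sym ab) , (b′ , a′ , gb′ , ga′ , ¬ab ∘ link-sym)

  lift-redDegree≤ : ∀ {k g} (nbrs : Cell → List Cell) → (∀ u → length (nbrs u) ≤ k) →
                    (∀ {u v} → RedLink g u v → v ∈ˡ nbrs u) → RedDegree≤ k (lift g)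
  lift-redDegree≤ {g = g} nbrs len covers x =
    map at (nbrs (cell x)) , ≤-trans (≤-reflexive (length-map at (nbrs (cell x)))) (len (cell x)) , λ {y} →
      λ ((x≢y , a , b , fa , fb , ab) , (a′ , b′ , fa′ , fb′ , ¬ab)) →
        subst (_∈ˡ _) (at-cell y) (∈-map⁺ at (covers
          ( (λ eq → x≢y (cell-injective eq))
          , (cell a , cell b , unlift fa , unlift fb , adj⇒link a ab)
          , (cell a′ , cell b′ , unlift fa′ , unlift fb′ , λ ab → ¬ab (link⇒adj a′ ab)))))
    where
    unlift : ∀ {z a} → lift g a ≡ z → g (cell a) ≡ cell z
    unlift {z} {a} eq = trans (sym (cell-at (g (cell a)))) (cong cell eq)

  redirect : Fin n → Fin n → Fin n → Fin n
  redirect x₁ x₂ y with y ≟ x₂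
  ... | yes _ = x₁
  ... | no  _ = y

  redirect-≡ : ∀ x₁ x₂ → redirect x₁ x₂ x₂ ≡ x₁
  redirect-≡ x₁ x₂ with x₂ ≟ x₂
  ... | yes _  = refl
  ... | no  ne = contradiction refl ne

  redirect-≢ : ∀ x₁ x₂ {y} → y ≢ x₂ → redirect x₁ x₂ y ≡ y
  redirect-≢ x₁ x₂ {y} ne with y ≟ x₂
  ... | yes eq = contradiction eq ne
  ... | no  _  = refl

  lastRow : Fin (suc N)
  lastRow = fromℕ N

  -- Second phase: only the last row is left, and it is shortened from its end.
  shorten : ℕ → Cell → Cell
  shorten s (_ , j) = lastRow , cap s j

  -- The quotient is a path, the spokes having collapsed, so even its total degree is at most 2.
  shorten-redDegree≤ : ∀ s → RedDegree≤ 3 (lift (shorten s))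
  shorten-redDegree≤ s = lift-redDegree≤ nbrs (λ _ → s≤s (s≤s z≤n)) covers
    where
    nbrs : Cell → List Cell
    nbrs (_ , j) = (lastRow , pred j) ∷ (lastRow , next j) ∷ []
    covers : ∀ {u v} → RedLink (shorten s) u v → v ∈ˡ nbrs u
    covers (u≢v , (_ , _ , refl , refl , spoke)   , _) = contradiction refl u≢v
    covers (u≢v , (_ , _ , refl , refl , spoke⁻¹) , _) = contradiction refl u≢v
    covers (u≢v , (_ , _ , refl , refl , along jk) , _) with cap-near s jk
    ... | inj₁ eq = contradiction (cong (lastRow ,_) eq) u≢v
    ... | inj₂ nr with near nr
    ...   | inj₁ eq = here (cong (lastRow ,_) eq)
    ...   | inj₂ eq = there (here (cong (lastRow ,_) eq))

  -- Going from `suc s` to `s` contracts the last vertex of the path into its predecessor. For `s`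
  -- at least `M` the two coincide and nothing is contracted.
  shorten-contractible : ∀ s → Contractible 3 (lift (shorten s))
  shorten-contractible zero    = constant-contractible (λ _ → refl) zero
  shorten-contractible (suc s) = step-contractible (shorten-redDegree≤ (suc s))
    (at (lastRow , cap s (fromℕ M)) ,
      trans (cong (at ∘ shorten (suc s)) (cell-at (lastRow , cap s (fromℕ M))))
            (cong (λ k → at (lastRow , k)) (cap-cap s (fromℕ M))))
    (redirect-≡ x₁ x₂) (redirect-≢ x₁ x₂) commutes (shorten-contractible s)
    where
    x₁ x₂ : Fin n
    x₁ = at (lastRow , cap s (fromℕ M))
    x₂ = at (lastRow , cap (suc s) (fromℕ M))
    fuse : ∀ j → at (lastRow , cap s j) ≡ redirect x₁ x₂ (at (lastRow , cap (suc s) j))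
    fuse j with cap (suc s) j ≟ cap (suc s) (fromℕ M)
    ... | yes eq = trans (cong (λ k → at (lastRow , k)) (cap-top s j eq))
              (sym (trans (cong (λ k → redirect x₁ x₂ (at (lastRow , k))) eq) (redirect-≡ x₁ x₂)))
    ... | no  ne = trans (cong (λ k → at (lastRow , k)) (cap-below s j ne))
              (sym (redirect-≢ x₁ x₂ (ne ∘ cong proj₂ ∘ at-injective)))
    commutes : lift (shorten s) ≗ redirect x₁ x₂ ∘ lift (shorten (suc s))
    commutes = fuse ∘ proj₂ ∘ cell

  -- Cells are numbered row by row: as `t` falls from `n` to zero in `sink`, the paths sink in order
  -- of decreasing row, each from its end, and the hubs, being row zero, come last.
  code : Cell → ℕ
  code = toℕ ∘ at

  code-injective : ∀ {u v} → code u ≡ code v → u ≡ v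
  code-injective = at-injective ∘ toℕ-injective

  -- First phase: the vertices of code at least t have moved down to the last row.
  sink : ℕ → Cell → Cell
  sink t u with code u <? t
  ... | yes _ = u
  ... | no  _ = lastRow , proj₂ u

  sink-< : ∀ {t u} → code u < t → sink t u ≡ u
  sink-< {t} {u} lt with code u <? t
  ... | yes _  = refl
  ... | no  ge = contradiction lt ge

  sink-≥ : ∀ {t u} → t ≤ code u → sink t u ≡ (lastRow , proj₂ u)
  sink-≥ {t} {u} ge with code u <? t
  ... | yes lt = contradiction ge (<⇒≱ lt)
  ... | no  _  = refl

  sink-lastRow : ∀ t j → sink t (lastRow , j) ≡ (lastRow , j)
  sink-lastRow t j with code (lastRow , j) <? t
  ... | yes _ = refl
  ... | no  _ = refl

  sink-column : ∀ t u → proj₂ (sink t u) ≡ proj₂ u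
  sink-column t u with code u <? t
  ... | yes _ = refl
  ... | no  _ = refl

  code-consecutive : ∀ {i : Fin N} {j k : Fin N} → Consecutive j k → suc (code (suc i , j)) ≡ code (suc i , k)
  code-consecutive {i} {j} {k} jk = begin
    suc (code (suc i , j))               ≡⟨ cong suc (toℕ-at (suc i) j) ⟩
    suc (N * toℕ (Fin.suc i) + toℕ j)    ≡⟨ sym (+-suc _ (toℕ j)) ⟩
    N * toℕ (Fin.suc i) + suc (toℕ j)    ≡⟨ cong (N * toℕ (Fin.suc i) +_) jk ⟩
    N * toℕ (Fin.suc i) + toℕ k          ≡⟨ sym (toℕ-at (suc i) k) ⟩
    code (suc i , k)                     ∎
    where open ≡-Reasoning

  code-near : ∀ {i : Fin N} {j k : Fin N} → Near j k → code (suc i , j) ≤ suc (code (suc i , k))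
  code-near (inj₁ jk) = ≤-trans (<⇒≤ (≤-reflexive (code-consecutive jk))) (n≤1+n _)
  code-near (inj₂ kj) = ≤-reflexive (sym (code-consecutive kj))

  code-spoke : ∀ {i j} → code (zero , j) < code (suc i , j)
  code-spoke {i} {j} = at-monoˡ-< {zero} {suc i} j (s≤s z≤n)

  -- Cells move only into the last row, which is never row zero, so a hub still in place is a class
  -- of its own.
  hub-unsunk : ∀ t {u j} → sink t u ≡ (zero , j) → u ≡ (zero , j)
  hub-unsunk t {u} eq with code u <? t
  ... | yes _ = eq
  ... | no  _ with () ← eq

  -- If the hub has sunk, so has the whole column, as path vertices have larger codes; then `u`
  -- equals `v`. Otherwise the hub is alone in its class, while the class of `v` stays within column
  -- `j`, whose path vertices are all adjacent to the hub.
  spoke-never-red : ∀ t {i j u v} → sink t (zero , j) ≡ u → sink t (suc i , j) ≡ v → ¬ RedLink (sink t) u v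
  spoke-never-red t {i} {j} {u} {v} ga gb (u≢v , _ , (a′ , b′ , ga′ , gb′ , ¬ab)) with code (zero , j) <? t
  ... | no  ge = u≢v (trans (sym ga) (trans (sym (sink-≥ (≤-trans (≮⇒≥ ge) (<⇒≤ (code-spoke {i}))))) gb))
  ... | yes lt with refl ← hub-unsunk t (trans ga′ (sym ga)) = notHub b′ gb′ ¬ab
    where
    notHub : ∀ b′ → sink t b′ ≡ v → ¬ ¬ Link (zero , j) b′
    notHub (suc i′ , j′) gb′ ¬ab
      with refl ← trans (sym (sink-column t (suc i′ , j′))) (trans (cong proj₂ (trans gb′ (sym gb))) (sink-column t (suc i , j)))
      = ¬ab spoke
    notHub (zero , j′) gb′ ¬ab
      with refl ← trans (sym (sink-column t (zero , j′))) (trans (cong proj₂ (trans gb′ (sym gb))) (sink-column t (suc i , j)))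
      = u≢v (trans (sym ga) (trans (sym (sink-< lt)) gb′))

  -- Spokes being black, only path edges count. They lead to the images of the two neighbours in the
  -- same row, except when a sunk vertex is joined to one still in place; then the latter is the
  -- frontier.
  sink-redDegree≤ : ∀ {t} → t < n → RedDegree≤ 3 (lift (sink (suc t)))
  sink-redDegree≤ {t} t<n = lift-redDegree≤ nbrs (λ _ → ≤-refl) covers
    where
    -- The last vertex still in place.
    frontier : Cell
    frontier = cell (fromℕ< t<n)
    code-frontier : code frontier ≡ t
    code-frontier = trans (cong toℕ (at-cell _)) (toℕ-fromℕ< t<n)
    nbrs : Cell → List Cell
    nbrs (i , j) = sink (suc t) (i , pred j) ∷ sink (suc t) (i , next j) ∷ frontier ∷ []
    beside : ∀ {i j k} → Near j k → sink (suc t) (i , k) ∈ˡ nbrs (i , j)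
    beside {i} jk with near jk
    ... | inj₁ eq = here (cong (λ k → sink (suc t) (i , k)) eq)
    ... | inj₂ eq = there (here (cong (λ k → sink (suc t) (i , k)) eq))
    path : ∀ i {j k} → Near j k → sink (suc t) (suc i , k) ∈ˡ nbrs (sink (suc t) (suc i , j))
    path i {j} {k} jk with code (suc i , j) <? suc t
    ... | yes _ = beside jk
    ... | no ge with code (suc i , k) <? suc t
    ...   | no _ = subst (_∈ˡ _) (sink-lastRow (suc t) k) (beside jk)
    -- The code of the unsunk end is at most `t`; that of the sunk end exceeds `t` and is larger by
    -- at most one. Hence the unsunk end has code `t`.
    ...   | yes lt = there (there (here (code-injective (trans (≤-antisym (m<1+n⇒m≤n lt)
                (≤-pred (≤-trans (≮⇒≥ ge) (code-near jk)))) (sym code-frontier)))))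
    covers : ∀ {u v} → RedLink (sink (suc t)) u v → v ∈ˡ nbrs u
    covers red@(_ , (_ , _ , ga , gb , spoke)   , _)        = contradiction red (spoke-never-red (suc t) ga gb)
    covers red@(_ , (_ , _ , ga , gb , spoke⁻¹) , _)        = contradiction (redLink-sym red) (spoke-never-red (suc t) gb ga)
    covers (_   , (_ , _ , refl , refl , along {i} jk) , _) = path i jk

  sink-contractible : ∀ t → t ≤ n → Contractible 3 (lift (sink t))
  sink-contractible zero _ = contractible-resp-≗
    -- Everything has sunk, and a cap at `N` changes no column index, so this is the start of the
    -- second phase.
    (λ x → cong at (trans (sink-≥ {u = cell x} z≤n) (cong (lastRow ,_) (sym (cap-id _ (<⇒≤ (toℕ<n _)))))))
    (shorten-contractible N)
  sink-contractible (suc t) t<n = step-contractible (sink-redDegree≤ t<n)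
    (x₁ , trans (cong (at ∘ sink (suc t)) (cell-at _)) (cong at (sink-lastRow (suc t) _)))
    (redirect-≡ x₁ x₂) (redirect-≢ x₁ x₂) (λ x → commutes (cell x)) (sink-contractible t (<⇒≤ t<n))
    where
    -- The cell of code `t` is merged into the last row of its column. If it lies there already,
    -- `x₁` and `x₂` coincide.
    x₁ x₂ : Fin n
    x₂ = fromℕ< t<n
    x₁ = at (lastRow , proj₂ (cell x₂))
    commutes : ∀ u → at (sink t u) ≡ redirect x₁ x₂ (at (sink (suc t) u))
    commutes u with <-cmp (code u) t
    ... | tri< lt _ _ = trans (cong at (sink-< lt)) (sym (trans
            (cong (redirect x₁ x₂ ∘ at) (sink-< (m<n⇒m<1+n lt)))
            (redirect-≢ x₁ x₂ λ eq → <-irrefl (trans (cong toℕ eq) (toℕ-fromℕ< t<n)) lt)))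
    ... | tri≈ _ eq _ = trans (cong at (trans (sink-≥ (≤-reflexive (sym eq))) (cong (λ z → lastRow , proj₂ z) u≡)))
            (sym (trans (cong (redirect x₁ x₂) (trans (cong at (sink-< (≤-reflexive (cong suc eq)))) at-u≡))
                        (redirect-≡ x₁ x₂)))
      where
      at-u≡ : at u ≡ x₂
      at-u≡ = toℕ-injective (trans eq (sym (toℕ-fromℕ< t<n)))
      u≡ : u ≡ cell x₂
      u≡ = trans (sym (cell-at u)) (cong cell at-u≡)
    ... | tri> _ _ gt = trans (cong at (sink-≥ (<⇒≤ gt))) (sym (trans
            (cong (redirect x₁ x₂ ∘ at) (sink-≥ gt)) fixed))
      where
      bottom : Fin n
      bottom = at (lastRow , proj₂ u)
      fixed : redirect x₁ x₂ bottom ≡ bottom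
      fixed with bottom ≟ x₂
      ... | no  _  = refl
      -- Here `x₂` lies in the last row itself, so `x₁` is the same vertex.
      ... | yes eq = cong (λ z → at (lastRow , proj₂ z)) (trans (cong cell (sym eq)) (cell-at _))

  twinWidth≤3 : TwinWidth≤ G 3
  twinWidth≤3 = contractible-resp-≗
    -- All codes are below `n`, so at `n` nothing has sunk and the quotient map is pointwise the
    -- identity.
    (λ x → sym (trans (cong at (sink-< (subst (_< n) (cong toℕ (sym (at-cell x))) (toℕ<n x)))) (at-cell x)))
    (sink-contractible n ≤-refl) id-isQuotient

  -- Tree-width at least `N`

  -- The branch sets of a K_{N,N} minor: the paths and the hubs.
  branch : Cell → Fin (N + N)
  branch (zero  , j) = N ↑ʳ j
  branch (suc i , j) = i ↑ˡ N

  label : Fin n → Fin (N + N)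
  label = branch ∘ cell

  label-at : ∀ u → label (at u) ≡ branch u
  label-at u = cong branch (cell-at u)

  ↑ˡ≢↑ʳ : ∀ {i j : Fin N} → i ↑ˡ N ≢ N ↑ʳ j
  ↑ˡ≢↑ʳ {i} {j} eq with () ← trans (sym (splitAt-↑ˡ N i N)) (trans (cong (splitAt N) eq) (splitAt-↑ʳ N N j))

  Step : Fin (N + N) → Fin n → Fin n → Set
  Step v x y = label x ≡ v × label y ≡ v × Adj G x y

  step-sym : ∀ {v x y} → Step v x y → Step v y x
  step-sym (x∈ , y∈ , xy) = y∈ , x∈ , Graph.symmetric G xy

  path-connected : ∀ (i : Fin N) j → Star (Step (i ↑ˡ N)) (at (suc i , zero)) (at (suc i , j))
  path-connected i = <-weakInduction _ ε λ j walk → walk ◅◅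
    (label-at _ , label-at _ , link⇒adj-at (along (inj₁ (cong suc (toℕ-inject₁ j))))) ◅ ε

  branch-connected : ∀ u w → branch u ≡ branch w → Star (Step (branch u)) (at u) (at w)
  branch-connected (zero  , j) (zero  , k) eq with refl ← ↑ʳ-injective N j k eq = ε
  branch-connected (zero  , j) (suc i , k) eq = contradiction (sym eq) ↑ˡ≢↑ʳ
  branch-connected (suc i , j) (zero  , k) eq = contradiction eq ↑ˡ≢↑ʳ
  branch-connected (suc i , j) (suc l , k) eq with refl ← ↑ˡ-injective N i l eq =
    reverse step-sym (path-connected i j) ◅◅ path-connected i k

  label-connected : ∀ v → ConnectedOn G (λ x → label x ≡ v)
  label-connected v {x} {y} refl eq = subst₂ (Star (Step v)) (at-cell x) (at-cell y)
    (branch-connected (cell x) (cell y) (sym eq))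

  data Branch : Fin (N + N) → Set where
    path : ∀ (i : Fin N) → Branch (i ↑ˡ N)
    hub  : ∀ (j : Fin N) → Branch (N ↑ʳ j)

  view : ∀ v → Branch v
  view v with splitAt N v in eq
  ... | inj₁ i = subst Branch (splitAt⁻¹-↑ˡ eq) (path i)
  ... | inj₂ j = subst Branch (splitAt⁻¹-↑ʳ eq) (hub j)

  -- The `j`-th vertex of each path joins it to hub `j`, so every branch set is adjacent to all `N`
  -- on the other side.
  treeWidth≥N : TreeWidth≥ G N
  treeWidth≥N D = minorMinDegree≤width D label nonEmpty label-connected neighbours
    where
    nonEmpty : ∀ v → ∃[ x ] label x ≡ v
    nonEmpty v with view v
    ... | path i = at (suc i , zero) , label-at _
    ... | hub  j = at (zero , j) , label-at _
    neighbours : ∀ v → Σ[ u ∈ (Fin N → Fin (N + N)) ] Injective _≡_ _≡_ u ×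
                 (∀ k → u k ≢ v × MinorAdj G label v (u k))
    neighbours v with view v
    ... | path i = (N ↑ʳ_) , ↑ʳ-injective N _ _ , λ j → ↑ˡ≢↑ʳ ∘ sym ,
            at (suc i , j) , at (zero , j) , label-at _ , label-at _ , link⇒adj-at spoke⁻¹
    ... | hub  j = (_↑ˡ N) , ↑ˡ-injective N _ _ , λ i → ↑ˡ≢↑ʳ ,
            at (zero , j) , at (suc i , j) , label-at _ , label-at _ , link⇒adj-at spoke

lemma3p7 : ∀ (N : ℕ) → .{{_ : NonZero N}} →
    Σ[ G ∈ Graph (N ^ 2 + N) ] (¬ (K 2 2 ⊑ G) × TwinWidth≤ G 3 × TreeWidth≥ G N)
lemma3p7 (suc M) = subst (λ n → Σ[ G ∈ Graph n ] (¬ (K 2 2 ⊑ G) × TwinWidth≤ G 3 × TreeWidth≥ G N))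
  -- `Paths` counts `N + N * N` vertices, hubs first, whereas `N ^ 2` unfolds to `N * (N * 1)`.
  (trans (+-comm N (N * N)) (cong (λ m → N * m + N) (sym (*-identityʳ N))))
  (G , K₂₂⋢G , twinWidth≤3 , treeWidth≥N)
  where open Paths M
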